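{- Let $p$ be an odd prime, let $\chi$ be the quadratic character modulo $p$ on $\mathbb F_p$, and let \[ T_p=\sum_{x\in\mathbb F_p}\chi(x^3-x). \] For $(\varepsilon_1,\varepsilon_2,\varepsilon_3)\in\{\pm1\}^3$ define \[ N(\varepsilon_1,\varepsilon_2,\varepsilon_3)=\#\{n\in\mathbb F_p:\ \chi(n-1)=\varepsilon_1,\ \chi(n)=\varepsilon_2,\ \chi(n+1)=\varepsilon_3\}. \] Then for every $(\varepsilon_1,\varepsilon_2,\varepsilon_3)\in\{\pm1\}^3$ the following hold. \begin{enumerate} \item If $p\equiv1\pmod8$, then \[ N(\varepsilon_1,\varepsilon_2,\varepsilon_3)=\frac18\Bigl(p-3-2\varepsilon_1-2\varepsilon_2-2\varepsilon_3-2\varepsilon_1\varepsilon_2-2\varepsilon_1\varepsilon_3-2\varepsilon_2\varepsilon_3+\varepsilon_1\varepsilon_2\varepsilon_3T_p\Bigr). \] \item If $p\equiv3\pmod8$, then \[ N(\varepsilon_1,\varepsilon_2,\varepsilon_3)=\frac18\Bigl(p-3+\varepsilon_1\varepsilon_2\varepsilon_3T_p\Bigr). \] \item If $p\equiv5\pmod8$, then \[ N(\varepsilon_1,\varepsilon_2,\varepsilon_3)=\frac18\Bigl(p-3-2\varepsilon_2-2\varepsilon_1\varepsilon_3+\varepsilon_1\varepsilon_2\varepsilon_3T_p\Bigr). \] \item If $p\equiv7\pmod8$, then \[ N(\varepsilon_1,\varepsilon_2,\varepsilon_3)=\frac18\Bigl(p-3+2\varepsilon_1-2\varepsilon_3-2\varepsilon_1\varepsilon_2-2\varepsilon_2\varepsilon_3+\varepsilon_1\varepsilon_2\varepsilon_3T_p\Bigr).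 \] \end{enumerate}
   Context: $\mathbb F_p=\mathbb Z/p\mathbb Z$. The quadratic character $\chi$ modulo $p$ (Legendre symbol) is the function $\chi:\mathbb F_p\to\{ -1,0,1\}$ with $\chi(0)=0$, $\chi(x)=1$ if $x$ is a nonzero square in $\mathbb F_p$, and $\chi(x)=-1$ if $x$ is not a square in $\mathbb F_p$. Sums of values of $\chi$ (such as the Jacobsthal sum $T_p$) are taken in $\mathbb Z$. -}

module Defs where

open import Algebra.Properties.CommutativeMonoid.Sum using (sum)
open import Data.Bool using (if_then_else_)
open import Data.Fin using (Fin; toℕ)
import Data.Fin.Properties as Fin
open import Data.Integer using (ℤ; 0ℤ; 1ℤ; -1ℤ)
import Data.Integer.Properties as ℤ
open import Data.List using (allFin; filter; length)
open import Data.Nat using (ℕ; NonZero; _+_; _*_; _∸_)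
open import Data.Nat.DivMod using (_mod_)
open import Data.Product using (∃; _×_)
open import Data.Sum using (_⊎_)
open import Relation.Binary.PropositionalEquality using (_≡_)
open import Relation.Nullary using (Dec; does)
open import Relation.Nullary.Decidable using (_×-dec_)

-- ℤ/pℤ, represented by the canonical residues 0, …, p - 1.
𝔽 : ℕ → Set
𝔽 = Fin

module _ {p : ℕ} .{{_ : NonZero p}} where

  infixl 6 _⊕_ _⊖_
  infixl 7 _⊗_
  infix 8 ⊝_

  0𝔽 1𝔽 : 𝔽 p
  0𝔽 = 0 mod p
  1𝔽 = 1 mod p

  _⊕_ _⊗_ _⊖_ : 𝔽 p → 𝔽 p → 𝔽 p
  ⊝_ : 𝔽 p → 𝔽 p
  x ⊕ y = (toℕ x + toℕ y) mod p
  x ⊗ y = (toℕ x * toℕ y) mod p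
  ⊝ x   = (p ∸ toℕ x) mod p
  x ⊖ y = x ⊕ ⊝ y

  IsSquare : 𝔽 p → Set
  IsSquare x = ∃ λ (y : 𝔽 p) → y ⊗ y ≡ x

  isSquare? : (x : 𝔽 p) → Dec (IsSquare x)
  isSquare? x = Fin.any? (λ y → y ⊗ y Fin.≟ x)

  χ : 𝔽 p → ℤ
  χ x = if does (x Fin.≟ 0𝔽) then 0ℤ
        else if does (isSquare? x) then 1ℤ
        else -1ℤ

T : (p : ℕ) .{{_ : NonZero p}} → ℤ
T p = sum ℤ.+-0-commutativeMonoid (λ (x : 𝔽 p) → χ (x ⊗ x ⊗ x ⊖ x))

module _ {p : ℕ} .{{_ : NonZero p}} (ε₁ ε₂ ε₃ : ℤ) where

  Pattern : 𝔽 p → Set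
  Pattern n = χ (n ⊖ 1𝔽) ≡ ε₁ × χ n ≡ ε₂ × χ (n ⊕ 1𝔽) ≡ ε₃

  pattern? : (n : 𝔽 p) → Dec (Pattern n)
  pattern? n = (χ (n ⊖ 1𝔽) ℤ.≟ ε₁) ×-dec (χ n ℤ.≟ ε₂) ×-dec (χ (n ⊕ 1𝔽) ℤ.≟ ε₃)

N : (p : ℕ) .{{_ : NonZero p}} → ℤ → ℤ → ℤ → ℕ
N p ε₁ ε₂ ε₃ = length (filter (pattern? ε₁ ε₂ ε₃) (allFin p))

IsPlusMinusOne : ℤ → Set
IsPlusMinusOne ε = ε ≡ 1ℤ ⊎ ε ≡ -1ℤ

{-# OPTIONS --safe #-}

-- For ε = ±1 the indicator of χ(x) = ε is ½ (1 + ε χ(x) − [x = 0]). Multiplying three such factors and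
-- summing over n gives 8N in terms of p, Σ χ = 0, the sums Σ χ(n) χ(n + a) = −1 for a ≠ 0, T_p, and
-- corrections at n = 0, ±1 that involve only χ(−1) and χ(2).
-- Both values come from the same counting: M = #{n : χ(−n) = χ(n + 1) = 1} satisfies 4M = p − 4 − χ(−1),
-- and the involution n ↦ −1 − n gives M ≡ (1 + χ(2)) / 2 mod 2, so that p ≡ 6 + χ(−1) + 2 χ(2) mod 8,
-- which determines the two signs from p mod 8.
module Submission where

open import Defs
open import Algebra.Bundles using (CommutativeRing; module AbelianGroup)
open import Algebra.Consequences.Propositional using (comm∧idˡ⇒id; comm∧invˡ⇒inv; comm∧distrʳ⇒distr)
import Algebra.Properties.Group
import Algebra.Properties.Ring
import Algebra.Properties.Semiring.Sum
import Algebra.Solver.Ring.NaturalCoefficients.Default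
open import Data.Bool using (true; false; if_then_else_)
open import Data.Fin using (Fin; zero; suc; toℕ; _<?_)
open import Data.Fin.Permutation using (permutation)
import Data.Fin.Properties as Fin
open import Data.Integer using (ℤ; +_; 0ℤ; 1ℤ; -1ℤ; _+_; _-_; _*_; -_; _≤_; ∣_∣; -≤+; +≤+)
import Data.Integer.Properties as ℤ
open import Data.Integer.Tactic.RingSolver using (solve-∀)
open import Data.List using (List; []; _∷_; filter; length; tabulate)
open import Data.List.Membership.Propositional using (_∈_)
open import Data.List.Relation.Unary.All using (All; all?; lookup)
open import Data.List.Relation.Unary.Any using (here; there)
open import Data.Nat as ℕ using (ℕ; NonZero)
open import Data.Nat.Coprimality using (prime⇒coprime; coprime-Bézout)
open import Data.Nat.DivMod as ℕ using (_%_; _mod_; m%n<n; m<n⇒m%n≡m; n%n≡0; m*n%n≡0; m≡m%n+[m/n]*n; %-distribˡ-+; %-distribˡ-*)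
open import Data.Nat.Divisibility using (_∣_; _∤_; _∣?_; divides; ∣-refl; m%n≡0⇒n∣m)
open import Data.Nat.GCD using (module Bézout)
open import Data.Nat.Primality using (Prime; ¬prime[1]; prime[2]; prime⇒irreducible)
import Data.Nat.Properties as ℕ
open import Data.Product using (∃; _×_; _,_; proj₁; proj₂)
open import Data.Rational using (_/_)
import Data.Rational.Properties as ℚ
open import Data.Rational.Unnormalised using (mkℚᵘ; *≡*)
open import Data.Sum using (_⊎_; inj₁; inj₂; [_,_]′)
open import Function using (_∘_; id; case_of_)
open import Level using (0ℓ)
open import Relation.Binary using (tri<; tri≈; tri>)
open import Relation.Binary.PropositionalEquality
open import Relation.Nullary using (Dec; does; yes; no; ¬_; contradiction)
open import Relation.Nullary.Decidable using (_×-dec_; _→-dec_; True; toWitness)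
open import Relation.Unary using (Decidable)

open Algebra.Properties.Group (AbelianGroup.group ℤ.+-0-abelianGroup) using () renaming (∙-cancelˡ to +-cancelˡ)
open Algebra.Properties.Semiring.Sum ℤ.+-*-semiring using (sum; sum-cong-≗; sum-replicate-zero; ∑-distrib-+; ∑-comm; sum-permute; *-distribˡ-sum)

-- Indicators and sums over Fin n

-- Because χ is defined by the existence of a root, the hard case of its multiplicativity is a
-- product of two non-squares. So Σ χ = 0 comes first, by counting the pairs (x, y) with y² = x in
-- two ways, and multiplicativity is deduced from it. M is built so that its two arguments -n and n
-- + 1 add up to 1: the involution swaps them, and its only fixed point is n = -½, where both equal
-- ½ and χ(½) = χ(2). This gives M = (1 + χ(2)) / 2 + 2k, and inserting it into the formula for 4M
-- produces the constant 6 = 4 + 2. The four sign pairs give 9, 5, 7 and 3, which are distinct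
-- modulo 8; this is why p mod 8 fixes both signs.

𝟙 : {P : Set} → Dec P → ℤ
𝟙 d = if does d then 1ℤ else 0ℤ

𝟙-yes : {P : Set} (d : Dec P) → P → 𝟙 d ≡ 1ℤ
𝟙-yes (yes _) _ = refl
𝟙-yes (no ¬q) q = contradiction q ¬q

𝟙-no : {P : Set} (d : Dec P) → ¬ P → 𝟙 d ≡ 0ℤ
𝟙-no (yes q) ¬q = contradiction q ¬q
𝟙-no (no _)  _  = refl

𝟙-cong : {P Q : Set} (d : Dec P) (e : Dec Q) → (P → Q) → (Q → P) → 𝟙 d ≡ 𝟙 e
𝟙-cong (yes q) e f g = sym (𝟙-yes e (f q))
𝟙-cong (no ¬q) e f g = sym (𝟙-no e (¬q ∘ g))

𝟙-disjoint : {P Q : Set} (d : Dec P) (e : Dec Q) → (P → ¬ Q) → 𝟙 d * 𝟙 e ≡ 0ℤ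
𝟙-disjoint (yes q) e f = cong (1ℤ *_) (𝟙-no e (f q))
𝟙-disjoint (no ¬q) e f = ℤ.*-zeroˡ (𝟙 e)

𝟙-idem : {P : Set} (d : Dec P) → 𝟙 d * 𝟙 d ≡ 𝟙 d
𝟙-idem (yes _) = refl
𝟙-idem (no _)  = refl

𝟙-×-dec : {P Q : Set} (d : Dec P) (e : Dec Q) → 𝟙 (d ×-dec e) ≡ 𝟙 d * 𝟙 e
𝟙-×-dec (yes _) e = sym (ℤ.*-identityˡ (𝟙 e))
𝟙-×-dec (no _)  e = sym (ℤ.*-zeroˡ (𝟙 e))

-- A record rather than the equation itself, so that f can be inferred from a proof.
infix 4 _HasSum_
record _HasSum_ {n} (f : Fin n → ℤ) (s : ℤ) : Set where
  constructor hasSum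
  field sum≡ : sum f ≡ s

open _HasSum_

infixl 6 _+ˢ_
infixr 7 _*ˢ_

_+ˢ_ : ∀ {n a b} {f g : Fin n → ℤ} → f HasSum a → g HasSum b → (λ i → f i + g i) HasSum a + b
_+ˢ_ {f = f} {g} (hasSum p) (hasSum q) = hasSum (trans (∑-distrib-+ f g) (cong₂ _+_ p q))

_*ˢ_ : ∀ {n a} {f : Fin n → ℤ} c → f HasSum a → (λ i → c * f i) HasSum c * a
_*ˢ_ {f = f} c (hasSum p) = hasSum (trans (sym (*-distribˡ-sum c f)) (cong (c *_) p))

sum-resp-≗ : ∀ {n a} {f g : Fin n → ℤ} → f ≗ g → g HasSum a → f HasSum a
sum-resp-≗ f≗g (hasSum p) = hasSum (trans (sum-cong-≗ f≗g) p)

sum-0 : ∀ {n} {f : Fin n → ℤ} → (∀ i → f i ≡ 0ℤ) → sum f ≡ 0ℤ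
sum-0 {n} f≗0 = trans (sum-cong-≗ f≗0) (sum-replicate-zero n)

sum-1 : ∀ n → (λ (i : Fin n) → 1ℤ) HasSum + n
sum-1 ℕ.zero    = hasSum refl
sum-1 (ℕ.suc n) = hasSum (cong (λ s → 1ℤ + s) (sum≡ (sum-1 n)))

sum-𝟙-* : ∀ {n} (c : Fin n) (f : Fin n → ℤ) → (λ i → 𝟙 (i Fin.≟ c) * f i) HasSum f c
sum-𝟙-* zero f = hasSum (begin
  1ℤ * f zero + sum (λ i → 0ℤ * f (suc i))  ≡⟨ cong₂ _+_ (ℤ.*-identityˡ (f zero)) (sum-0 (ℤ.*-zeroˡ ∘ f ∘ suc)) ⟩
  f zero + 0ℤ                               ≡⟨ ℤ.+-identityʳ (f zero) ⟩
  f zero                                    ∎)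
  where open ≡-Reasoning
sum-𝟙-* (suc c) f = hasSum (begin
  0ℤ * f zero + sum (λ i → 𝟙 (i Fin.≟ c) * f (suc i))  ≡⟨ cong₂ _+_ (ℤ.*-zeroˡ (f zero)) (sum≡ (sum-𝟙-* c (f ∘ suc))) ⟩
  0ℤ + f (suc c)                                       ≡⟨ ℤ.+-identityˡ (f (suc c)) ⟩
  f (suc c)                                            ∎)
  where open ≡-Reasoning

sum-𝟙 : ∀ {n} (c : Fin n) → (λ i → 𝟙 (i Fin.≟ c)) HasSum 1ℤ
sum-𝟙 c = sum-resp-≗ (λ i → sym (ℤ.*-identityʳ (𝟙 (i Fin.≟ c)))) (sum-𝟙-* c (λ _ → 1ℤ))

sum-bijection : ∀ {n} (σ τ : Fin n → Fin n) → (∀ i → σ (τ i) ≡ i) → (∀ i → τ (σ i) ≡ i) →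
  (f : Fin n → ℤ) → sum (f ∘ σ) ≡ sum f
sum-bijection σ τ στ τσ f = sym (sum-permute f (permutation σ τ στ τσ))

-- Points that are not fixed come in pairs {i, σ i} on which `f` is constant, so their contribution
-- is even. The witness sums `f` over the smaller member of each pair.
sum-involution : ∀ {n} (σ : Fin n → Fin n) → (∀ i → σ (σ i) ≡ i) →
  (f : Fin n → ℤ) → (∀ i → f (σ i) ≡ f i) →
  ∃ λ k → sum f ≡ sum (λ i → 𝟙 (σ i Fin.≟ i) * f i) + + 2 * k
sum-involution {n} σ σσ f fσ = sum below , (begin
  sum f                                                ≡⟨ sum-cong-≗ split ⟩
  sum (λ i → fixed i + (below i + above i))            ≡⟨ sum≡ (hasSum {f = fixed} refl +ˢ (hasSum {f = below} refl +ˢ hasSum {f = above} above≡below)) ⟩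
  sum fixed + (sum below + sum below)                  ≡⟨ cong (λ s → sum fixed + s) (x+x≡2x (sum below)) ⟩
  sum fixed + + 2 * sum below                          ∎)
  where
  open ≡-Reasoning
  fixed below above : Fin n → ℤ
  fixed i = 𝟙 (σ i Fin.≟ i) * f i
  below i = 𝟙 (i <? σ i) * f i
  above i = 𝟙 (σ i <? i) * f i

  x+x≡2x : ∀ x → x + x ≡ + 2 * x
  x+x≡2x = solve-∀

  -- The indicators enter through variables so that at each call the last equation is between
  -- numerals and holds by `refl`.
  combine : ∀ i {a b c} → 𝟙 (σ i Fin.≟ i) ≡ a → 𝟙 (i <? σ i) ≡ b → 𝟙 (σ i <? i) ≡ c →
    a + (b + c) ≡ 1ℤ → f i ≡ fixed i + (below i + above i)
  combine i {a} {b} {c} refl refl refl eq = begin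
    f i                                ≡⟨ ℤ.*-identityˡ (f i) ⟨
    1ℤ * f i                           ≡⟨ cong (_* f i) eq ⟨
    (a + (b + c)) * f i                ≡⟨ expand a b c (f i) ⟩
    a * f i + (b * f i + c * f i)      ∎
    where
    expand : ∀ a b c x → (a + (b + c)) * x ≡ a * x + (b * x + c * x)
    expand = solve-∀

  split : ∀ i → f i ≡ fixed i + (below i + above i)
  split i with Fin.<-cmp i (σ i)
  ... | tri< lt ¬eq ¬gt = combine i (𝟙-no (σ i Fin.≟ i) (¬eq ∘ sym)) (𝟙-yes (i <? σ i) lt) (𝟙-no (σ i <? i) ¬gt) refl
  ... | tri≈ ¬lt eq ¬gt = combine i (𝟙-yes (σ i Fin.≟ i) (sym eq)) (𝟙-no (i <? σ i) ¬lt) (𝟙-no (σ i <? i) ¬gt) refl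
  ... | tri> ¬lt ¬eq gt = combine i (𝟙-no (σ i Fin.≟ i) (¬eq ∘ sym)) (𝟙-no (i <? σ i) ¬lt) (𝟙-yes (σ i <? i) gt) refl

  above≡below : sum above ≡ sum below
  -- Substituting σ i for i turns the larger members of the pairs into the smaller ones.
  above≡below = trans (sym (sum-bijection σ σ σσ σσ above))
    (sum-cong-≗ (λ i → cong₂ (λ j x → 𝟙 (j <? σ i) * x) (σσ i) (fσ i)))

sum-mono-≤ : ∀ {n} {f g : Fin n → ℤ} → (∀ i → f i ≤ g i) → sum f ≤ sum g
sum-mono-≤ {ℕ.zero}  f≤g = ℤ.≤-refl
sum-mono-≤ {ℕ.suc n} f≤g = ℤ.+-mono-≤ (f≤g zero) (sum-mono-≤ (f≤g ∘ suc))

-- A strict inequality at one index could not be compensated at the others. This turns the bound for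
-- a non-square in `χ-⊗` into an equality.
sum-≤-antisym : ∀ {n} {f g : Fin n → ℤ} → (∀ i → f i ≤ g i) → sum f ≡ sum g → ∀ i → f i ≡ g i
sum-≤-antisym {ℕ.suc n} {f} {g} f≤g eq = λ where
    zero    → head≡
    (suc i) → sum-≤-antisym (f≤g ∘ suc) tail≡ i
  where
  head≡ : f zero ≡ g zero
  head≡ with f zero ℤ.≟ g zero
  ... | yes e = e
  ... | no ≢  = contradiction eq (ℤ.<⇒≢ (ℤ.+-mono-<-≤ (ℤ.≤∧≢⇒< (f≤g zero) ≢) (sum-mono-≤ (f≤g ∘ suc))))
  tail≡ : sum (f ∘ suc) ≡ sum (g ∘ suc)
  tail≡ = +-cancelˡ (f zero) _ _ (trans eq (cong (_+ sum (g ∘ suc)) (sym head≡)))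

-- `allFin p` is `tabulate id`, so the case g = id turns the count `N` into a sum; a general g lets
-- the induction pass to `g ∘ suc`.
length-filter-tabulate : ∀ {A : Set} {P : A → Set} (P? : Decidable P) {n} (g : Fin n → A) →
  + length (filter P? (tabulate g)) ≡ sum (λ i → 𝟙 (P? (g i)))
length-filter-tabulate P? {ℕ.zero}  g = refl
length-filter-tabulate P? {ℕ.suc n} g with does (P? (g zero))
... | true  = cong (λ s → 1ℤ + s) (length-filter-tabulate P? (g ∘ suc))
... | false = trans (length-filter-tabulate P? (g ∘ suc)) (sym (ℤ.+-identityˡ _))

-- The ring ℤ/pℤ

module Residues (p : ℕ) .{{_ : NonZero p}} where

  ⟦_⟧ : ℕ → 𝔽 p
  ⟦ m ⟧ = m mod p

  toℕ-mod : ∀ m → toℕ ⟦ m ⟧ ≡ m % p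
  toℕ-mod m = Fin.toℕ-fromℕ< (m%n<n m p)

  mod-cong : ∀ {m n} → m % p ≡ n % p → ⟦ m ⟧ ≡ ⟦ n ⟧
  mod-cong {m} {n} eq = Fin.toℕ-injective (trans (toℕ-mod m) (trans eq (sym (toℕ-mod n))))

  toℕ%p : (x : 𝔽 p) → toℕ x % p ≡ toℕ x
  toℕ%p x = m<n⇒m%n≡m (Fin.toℕ<n x)

  mod-toℕ : (x : 𝔽 p) → ⟦ toℕ x ⟧ ≡ x
  mod-toℕ x = Fin.toℕ-injective (trans (toℕ-mod (toℕ x)) (toℕ%p x))

  mod-+ : ∀ m n → ⟦ m ℕ.+ n ⟧ ≡ ⟦ m ⟧ ⊕ ⟦ n ⟧
  mod-+ m n = mod-cong (trans (%-distribˡ-+ m n p)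
    (cong₂ (λ a b → (a ℕ.+ b) % p) (sym (toℕ-mod m)) (sym (toℕ-mod n))))

  mod-* : ∀ m n → ⟦ m ℕ.* n ⟧ ≡ ⟦ m ⟧ ⊗ ⟦ n ⟧
  mod-* m n = mod-cong (trans (%-distribˡ-* m n p)
    (cong₂ (λ a b → (a ℕ.* b) % p) (sym (toℕ-mod m)) (sym (toℕ-mod n))))

  -- The argument m need not be reduced. This removes the inner reduction in a nested sum, so that
  -- the ring laws are inherited from ℕ.
  ⊕-toℕ : ∀ m (x : 𝔽 p) → ⟦ m ℕ.+ toℕ x ⟧ ≡ ⟦ m ⟧ ⊕ x
  ⊕-toℕ m x = trans (mod-+ m (toℕ x)) (cong (⟦ m ⟧ ⊕_) (mod-toℕ x))

  ⊗-toℕ : ∀ m (x : 𝔽 p) → ⟦ m ℕ.* toℕ x ⟧ ≡ ⟦ m ⟧ ⊗ x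
  ⊗-toℕ m x = trans (mod-* m (toℕ x)) (cong (⟦ m ⟧ ⊗_) (mod-toℕ x))

  ⊕-comm : (x y : 𝔽 p) → x ⊕ y ≡ y ⊕ x
  ⊕-comm x y = cong ⟦_⟧ (ℕ.+-comm (toℕ x) (toℕ y))

  ⊗-comm : (x y : 𝔽 p) → x ⊗ y ≡ y ⊗ x
  ⊗-comm x y = cong ⟦_⟧ (ℕ.*-comm (toℕ x) (toℕ y))

  ⊕-assoc : (x y z : 𝔽 p) → (x ⊕ y) ⊕ z ≡ x ⊕ (y ⊕ z)
  ⊕-assoc x y z = begin
    (x ⊕ y) ⊕ z                      ≡⟨ ⊕-toℕ (toℕ x ℕ.+ toℕ y) z ⟨
    ⟦ toℕ x ℕ.+ toℕ y ℕ.+ toℕ z ⟧    ≡⟨ cong ⟦_⟧ (ℕ.+-assoc (toℕ x) (toℕ y) (toℕ z)) ⟩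
    ⟦ toℕ x ℕ.+ (toℕ y ℕ.+ toℕ z) ⟧  ≡⟨ mod-+ (toℕ x) (toℕ y ℕ.+ toℕ z) ⟩
    ⟦ toℕ x ⟧ ⊕ (y ⊕ z)              ≡⟨ cong (_⊕ (y ⊕ z)) (mod-toℕ x) ⟩
    x ⊕ (y ⊕ z)                      ∎
    where open ≡-Reasoning

  ⊗-assoc : (x y z : 𝔽 p) → (x ⊗ y) ⊗ z ≡ x ⊗ (y ⊗ z)
  ⊗-assoc x y z = begin
    (x ⊗ y) ⊗ z                      ≡⟨ ⊗-toℕ (toℕ x ℕ.* toℕ y) z ⟨
    ⟦ toℕ x ℕ.* toℕ y ℕ.* toℕ z ⟧    ≡⟨ cong ⟦_⟧ (ℕ.*-assoc (toℕ x) (toℕ y) (toℕ z)) ⟩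
    ⟦ toℕ x ℕ.* (toℕ y ℕ.* toℕ z) ⟧  ≡⟨ mod-* (toℕ x) (toℕ y ℕ.* toℕ z) ⟩
    ⟦ toℕ x ⟧ ⊗ (y ⊗ z)              ≡⟨ cong (_⊗ (y ⊗ z)) (mod-toℕ x) ⟩
    x ⊗ (y ⊗ z)                      ∎
    where open ≡-Reasoning

  ⊗-distribʳ-⊕ : (x y z : 𝔽 p) → (y ⊕ z) ⊗ x ≡ y ⊗ x ⊕ z ⊗ x
  ⊗-distribʳ-⊕ x y z = begin
    (y ⊕ z) ⊗ x                              ≡⟨ ⊗-toℕ (toℕ y ℕ.+ toℕ z) x ⟨
    ⟦ (toℕ y ℕ.+ toℕ z) ℕ.* toℕ x ⟧          ≡⟨ cong ⟦_⟧ (ℕ.*-distribʳ-+ (toℕ x) (toℕ y) (toℕ z)) ⟩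
    ⟦ toℕ y ℕ.* toℕ x ℕ.+ toℕ z ℕ.* toℕ x ⟧  ≡⟨ mod-+ (toℕ y ℕ.* toℕ x) (toℕ z ℕ.* toℕ x) ⟩
    y ⊗ x ⊕ z ⊗ x                            ∎
    where open ≡-Reasoning

  ⊕-identityˡ : (x : 𝔽 p) → 0𝔽 ⊕ x ≡ x
  ⊕-identityˡ x = trans (sym (⊕-toℕ 0 x)) (mod-toℕ x)

  ⊗-identityˡ : (x : 𝔽 p) → 1𝔽 ⊗ x ≡ x
  ⊗-identityˡ x = trans (sym (⊗-toℕ 1 x)) (trans (cong ⟦_⟧ (ℕ.*-identityˡ (toℕ x))) (mod-toℕ x))

  p-mod : ⟦ p ⟧ ≡ 0𝔽
  p-mod = mod-cong {p} {0} (trans (n%n≡0 p) (sym (m*n%n≡0 0 p)))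

  ⊝-inverseˡ : (x : 𝔽 p) → ⊝ x ⊕ x ≡ 0𝔽
  ⊝-inverseˡ x = begin
    ⟦ p ℕ.∸ toℕ x ⟧ ⊕ x        ≡⟨ ⊕-toℕ (p ℕ.∸ toℕ x) x ⟨
    ⟦ p ℕ.∸ toℕ x ℕ.+ toℕ x ⟧  ≡⟨ cong ⟦_⟧ (ℕ.m∸n+n≡m (ℕ.<⇒≤ (Fin.toℕ<n x))) ⟩
    ⟦ p ⟧                      ≡⟨ p-mod ⟩
    0𝔽                         ∎
    where open ≡-Reasoning

  𝔽-ring : CommutativeRing 0ℓ 0ℓ
  𝔽-ring = record
    { Carrier = 𝔽 p ; _≈_ = _≡_ ; _+_ = _⊕_ ; _*_ = _⊗_ ; -_ = ⊝_ ; 0# = 0𝔽 ; 1# = 1𝔽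
    ; isCommutativeRing = record
      { isRing = record
        { +-isAbelianGroup = record
          { isGroup = record
            { isMonoid = record
              { isSemigroup = record
                { isMagma = record { isEquivalence = isEquivalence ; ∙-cong = cong₂ _⊕_ }
                ; assoc = ⊕-assoc }
              ; identity = comm∧idˡ⇒id ⊕-comm ⊕-identityˡ }
            ; inverse = comm∧invˡ⇒inv ⊕-comm ⊝-inverseˡ
            ; ⁻¹-cong = cong ⊝_ }
          ; comm = ⊕-comm }
        ; *-cong = cong₂ _⊗_
        ; *-assoc = ⊗-assoc
        ; *-identity = comm∧idˡ⇒id ⊗-comm ⊗-identityˡ
        ; distrib = comm∧distrʳ⇒distr (cong₂ _⊕_) ⊗-comm ⊗-distribʳ-⊕ }
      ; *-comm = ⊗-comm } }

  module R = CommutativeRing 𝔽-ring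
  open Algebra.Properties.Ring R.ring public
    using (-‿distribˡ-*; -‿distribʳ-*; -‿involutive; +-inverseˡ-unique; x∙y⁻¹≈ε⇒x≈y; -1*x≈-x; -‿+-comm; -0#≈0#)
  -- This solver covers commutative semirings: in the calls below a negative enters as a further
  -- variable, and its cancellation is a separate step.
  open Algebra.Solver.Ring.NaturalCoefficients.Default R.commutativeSemiring public
    using (solve; _:=_; _:+_; _:*_)

  -- Bézout: either m x = 1 + k p, or 1 + m x = k p and −m is the inverse.
  ∃-inverse : Prime p → (x : 𝔽 p) → x ≢ 0𝔽 → ∃ λ y → x ⊗ y ≡ 1𝔽
  ∃-inverse pr x x≢0 with coprime-Bézout (prime⇒coprime pr {{ℕ.≢-nonZero toℕx≢0}} (Fin.toℕ<n x))
    where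
    toℕx≢0 : toℕ x ≢ 0
    toℕx≢0 eq = x≢0 (trans (sym (mod-toℕ x)) (cong ⟦_⟧ eq))
  ... | Bézout.-+ k m eq = ⟦ m ⟧ , (begin
    x ⊗ ⟦ m ⟧           ≡⟨ ⊗-comm x _ ⟩
    ⟦ m ⟧ ⊗ x           ≡⟨ ⊗-toℕ m x ⟨
    ⟦ m ℕ.* toℕ x ⟧     ≡⟨ cong ⟦_⟧ eq ⟨
    ⟦ 1 ℕ.+ k ℕ.* p ⟧   ≡⟨ mod-+ 1 (k ℕ.* p) ⟩
    1𝔽 ⊕ ⟦ k ℕ.* p ⟧    ≡⟨ cong (1𝔽 ⊕_) (mod-* k p) ⟩
    1𝔽 ⊕ ⟦ k ⟧ ⊗ ⟦ p ⟧  ≡⟨ cong (λ z → 1𝔽 ⊕ ⟦ k ⟧ ⊗ z) p-mod ⟩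
    1𝔽 ⊕ ⟦ k ⟧ ⊗ 0𝔽     ≡⟨ cong (1𝔽 ⊕_) (R.zeroʳ ⟦ k ⟧) ⟩
    1𝔽 ⊕ 0𝔽             ≡⟨ R.+-identityʳ _ ⟩
    1𝔽                  ∎)
    where open ≡-Reasoning
  ... | Bézout.+- k m eq = ⊝ ⟦ m ⟧ , (begin
    x ⊗ ⊝ ⟦ m ⟧                       ≡⟨ -‿distribʳ-* x _ ⟨
    ⊝ (x ⊗ ⟦ m ⟧)                     ≡⟨ R.+-identityˡ _ ⟨
    0𝔽 ⊕ ⊝ (x ⊗ ⟦ m ⟧)                ≡⟨ cong (_⊕ ⊝ (x ⊗ ⟦ m ⟧)) 1+xm≡0 ⟨
    1𝔽 ⊕ x ⊗ ⟦ m ⟧ ⊕ ⊝ (x ⊗ ⟦ m ⟧)    ≡⟨ ⊕-assoc _ _ _ ⟩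
    1𝔽 ⊕ (x ⊗ ⟦ m ⟧ ⊕ ⊝ (x ⊗ ⟦ m ⟧))  ≡⟨ cong (1𝔽 ⊕_) (R.-‿inverseʳ _) ⟩
    1𝔽 ⊕ 0𝔽                           ≡⟨ R.+-identityʳ _ ⟩
    1𝔽                                ∎)
    where
    open ≡-Reasoning
    1+xm≡0 : 1𝔽 ⊕ x ⊗ ⟦ m ⟧ ≡ 0𝔽
    1+xm≡0 = begin
      1𝔽 ⊕ x ⊗ ⟦ m ⟧         ≡⟨ cong (1𝔽 ⊕_) (⊗-comm x _) ⟩
      1𝔽 ⊕ ⟦ m ⟧ ⊗ x         ≡⟨ cong (1𝔽 ⊕_) (⊗-toℕ m x) ⟨
      1𝔽 ⊕ ⟦ m ℕ.* toℕ x ⟧   ≡⟨ mod-+ 1 (m ℕ.* toℕ x) ⟨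
      ⟦ 1 ℕ.+ m ℕ.* toℕ x ⟧  ≡⟨ cong ⟦_⟧ eq ⟩
      ⟦ k ℕ.* p ⟧            ≡⟨ mod-* k p ⟩
      ⟦ k ⟧ ⊗ ⟦ p ⟧          ≡⟨ cong (⟦ k ⟧ ⊗_) p-mod ⟩
      ⟦ k ⟧ ⊗ 0𝔽             ≡⟨ R.zeroʳ ⟦ k ⟧ ⟩
      0𝔽                     ∎

-- The quadratic character

signs : List (ℤ × ℤ)
signs = (1ℤ , 1ℤ) ∷ (1ℤ , -1ℤ) ∷ (-1ℤ , 1ℤ) ∷ (-1ℤ , -1ℤ) ∷ []

∈-signs : ∀ {s t} → IsPlusMinusOne s → IsPlusMinusOne t → (s , t) ∈ signs
∈-signs (inj₁ refl) (inj₁ refl) = here refl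
∈-signs (inj₁ refl) (inj₂ refl) = there (here refl)
∈-signs (inj₂ refl) (inj₁ refl) = there (there (here refl))
∈-signs (inj₂ refl) (inj₂ refl) = there (there (there (here refl)))

-- In use r = p % 8, s = χ(-1) and t = χ(2). Divisibility of an absolute value is decidable, so the
-- claim for all four sign pairs can be settled by evaluation.
Determines : ℕ → ℤ → ℤ → ℤ × ℤ → Set
Determines r s₀ t₀ (s , t) = 8 ∣ ∣ + r - (+ 6 + s + + 2 * t) ∣ → s ≡ s₀ × t ≡ t₀

determines? : ∀ r s₀ t₀ → Dec (All (Determines r s₀ t₀) signs)
determines? r s₀ t₀ = all? (λ (s , t) → (8 ∣? ∣ + r - (+ 6 + s + + 2 * t) ∣) →-dec (s ℤ.≟ s₀ ×-dec t ℤ.≟ t₀)) signs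

-- Eight times the count, in terms of s = χ(−1) and t = χ(2).
8N-formula : (P s t τ ε₁ ε₂ ε₃ : ℤ) → ℤ
8N-formula P s t τ ε₁ ε₂ ε₃ = P - + 3 - (s + s * t) * ε₁ - (1ℤ + s) * ε₂ - (1ℤ + t) * ε₃
  - (1ℤ + s * s * t) * ε₁ * ε₂ - (1ℤ + s) * ε₁ * ε₃ - (1ℤ + t) * ε₂ * ε₃ + ε₁ * ε₂ * ε₃ * τ

-- The premises have the shape of `2*𝟙[χ≡ε]`, with corrections d and e that sit at different points,
-- whence d e = 0. Differences are written with `-1ℤ *` so that every term is one that `_+ˢ_` and
-- `_*ˢ_` can sum.
expand₂ : ∀ {A B a b d e} → + 2 * a ≡ A + -1ℤ * d → + 2 * b ≡ B + -1ℤ * e → d * e ≡ 0ℤ →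
  + 4 * (a * b) ≡ A * B + -1ℤ * (d * B) + -1ℤ * (e * A)
expand₂ {A} {B} {a} {b} {d} {e} eq₁ eq₂ de≡0 = begin
  + 4 * (a * b)                                    ≡⟨ split a b ⟩
  + 2 * a * (+ 2 * b)                              ≡⟨ cong₂ _*_ eq₁ eq₂ ⟩
  (A + -1ℤ * d) * (B + -1ℤ * e)                    ≡⟨ multiply A B d e ⟩
  A * B + -1ℤ * (d * B) + -1ℤ * (e * A) + d * e    ≡⟨ cong (λ u → A * B + -1ℤ * (d * B) + -1ℤ * (e * A) + u) de≡0 ⟩
  A * B + -1ℤ * (d * B) + -1ℤ * (e * A) + 0ℤ       ≡⟨ ℤ.+-identityʳ _ ⟩
  A * B + -1ℤ * (d * B) + -1ℤ * (e * A)            ∎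
  where
  open ≡-Reasoning
  split : ∀ a b → + 4 * (a * b) ≡ + 2 * a * (+ 2 * b)
  split = solve-∀
  multiply : ∀ A B d e → (A + -1ℤ * d) * (B + -1ℤ * e) ≡ A * B + -1ℤ * (d * B) + -1ℤ * (e * A) + d * e
  multiply = solve-∀

expand₃ : ∀ {A B C a b c d e f} →
  + 2 * a ≡ A + -1ℤ * d → + 2 * b ≡ B + -1ℤ * e → + 2 * c ≡ C + -1ℤ * f →
  d * e ≡ 0ℤ → d * f ≡ 0ℤ → e * f ≡ 0ℤ →
  + 8 * (a * (b * c)) ≡ A * B * C + -1ℤ * (d * (B * C)) + -1ℤ * (e * (A * C)) + -1ℤ * (f * (A * B))
expand₃ {A} {B} {C} {a} {b} {c} {d} {e} {f} eq₁ eq₂ eq₃ de≡0 df≡0 ef≡0 = begin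
  + 8 * (a * (b * c))                                    ≡⟨ split a b c ⟩
  + 2 * a * (+ 2 * b * (+ 2 * c))                        ≡⟨ cong₂ _*_ eq₁ (cong₂ _*_ eq₂ eq₃) ⟩
  (A + -1ℤ * d) * ((B + -1ℤ * e) * (C + -1ℤ * f))        ≡⟨ multiply A B C d e f ⟩
  -- Every remaining term contains a product of two corrections; the triple product d e f is grouped
  -- with e f.
  rhs + (d * e * C + d * f * B + e * f * (A + -1ℤ * d))
    ≡⟨ cong (λ u → rhs + u) (cong₂ _+_ (cong₂ _+_ (cong (_* C) de≡0) (cong (_* B) df≡0)) (cong (_* (A + -1ℤ * d)) ef≡0)) ⟩
  rhs + (0ℤ * C + 0ℤ * B + 0ℤ * (A + -1ℤ * d))           ≡⟨ drop rhs C B (A + -1ℤ * d) ⟩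
  rhs                                                    ∎
  where
  open ≡-Reasoning
  rhs : ℤ
  rhs = A * B * C + -1ℤ * (d * (B * C)) + -1ℤ * (e * (A * C)) + -1ℤ * (f * (A * B))
  split : ∀ a b c → + 8 * (a * (b * c)) ≡ + 2 * a * (+ 2 * b * (+ 2 * c))
  split = solve-∀
  multiply : ∀ A B C d e f → (A + -1ℤ * d) * ((B + -1ℤ * e) * (C + -1ℤ * f)) ≡
    A * B * C + -1ℤ * (d * (B * C)) + -1ℤ * (e * (A * C)) + -1ℤ * (f * (A * B))
      + (d * e * C + d * f * B + e * f * (A + -1ℤ * d))
  multiply = solve-∀
  drop : ∀ x u v w → x + (0ℤ * u + 0ℤ * v + 0ℤ * w) ≡ x
  drop = solve-∀

-- Arithmetic of the field for odd p

module OddPrime (p : ℕ) .{{_ : NonZero p}} (pr : Prime p) (2∤p : 2 ∤ p) where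

  open Residues p
  open ≡-Reasoning

  2𝔽 : 𝔽 p
  2𝔽 = 1𝔽 ⊕ 1𝔽

  -- If 1 + 1 = 0 then p divides 2, so p is 1, which is not prime, or 2, which is even.
  2≢0 : 2𝔽 ≢ 0𝔽
  2≢0 eq = [ (λ { refl → contradiction pr ¬prime[1] }) , (λ { refl → 2∤p ∣-refl }) ]′
    (prime⇒irreducible prime[2] (m%n≡0⇒n∣m 2 p 2%p≡0))
    where
    2%p≡0 : 2 % p ≡ 0
    2%p≡0 = begin
      2 % p          ≡⟨ toℕ-mod 2 ⟨
      toℕ ⟦ 2 ⟧      ≡⟨ cong toℕ (trans (mod-+ 1 1) eq) ⟩
      toℕ ⟦ 0 ⟧      ≡⟨ toℕ-mod 0 ⟩
      0 % p          ≡⟨ m*n%n≡0 0 p ⟩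
      0              ∎

  1≢0 : 1𝔽 ≢ 0𝔽
  1≢0 eq = 2≢0 (trans (cong₂ _⊕_ eq eq) (⊕-identityˡ 0𝔽))

  -- The default value 0 at 0 makes `inv` an involution of the whole field, hence usable as a change
  -- of variable in sums.
  inv : 𝔽 p → 𝔽 p
  inv x with x Fin.≟ 0𝔽
  ... | yes _  = 0𝔽
  ... | no x≢0 = proj₁ (∃-inverse pr x x≢0)

  inv-0 : inv 0𝔽 ≡ 0𝔽
  inv-0 with 0𝔽 Fin.≟ 0𝔽
  ... | yes _  = refl
  ... | no 0≢0 = contradiction refl 0≢0

  ⊗-inv : ∀ {x} → x ≢ 0𝔽 → x ⊗ inv x ≡ 1𝔽
  ⊗-inv {x} x≢0 with x Fin.≟ 0𝔽
  ... | yes x≡0 = contradiction x≡0 x≢0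
  ... | no  ≢0  = proj₂ (∃-inverse pr x ≢0)

  inv-⊗-⊗ : ∀ {x} y → x ≢ 0𝔽 → inv x ⊗ (x ⊗ y) ≡ y
  inv-⊗-⊗ {x} y x≢0 = begin
    inv x ⊗ (x ⊗ y)  ≡⟨ ⊗-assoc (inv x) x y ⟨
    inv x ⊗ x ⊗ y    ≡⟨ cong (_⊗ y) (trans (⊗-comm (inv x) x) (⊗-inv x≢0)) ⟩
    1𝔽 ⊗ y           ≡⟨ ⊗-identityˡ y ⟩
    y                ∎

  ⊗-inv-⊗ : ∀ {x} y → x ≢ 0𝔽 → x ⊗ (inv x ⊗ y) ≡ y
  ⊗-inv-⊗ {x} y x≢0 = begin
    x ⊗ (inv x ⊗ y)  ≡⟨ ⊗-assoc x (inv x) y ⟨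
    x ⊗ inv x ⊗ y    ≡⟨ cong (_⊗ y) (⊗-inv x≢0) ⟩
    1𝔽 ⊗ y           ≡⟨ ⊗-identityˡ y ⟩
    y                ∎

  integral : ∀ {x y} → x ≢ 0𝔽 → x ⊗ y ≡ 0𝔽 → y ≡ 0𝔽
  integral {x} {y} x≢0 eq = begin
    y                ≡⟨ inv-⊗-⊗ y x≢0 ⟨
    inv x ⊗ (x ⊗ y)  ≡⟨ cong (inv x ⊗_) eq ⟩
    inv x ⊗ 0𝔽       ≡⟨ R.zeroʳ (inv x) ⟩
    0𝔽               ∎

  ⊗-≢0 : ∀ {x y} → x ≢ 0𝔽 → y ≢ 0𝔽 → x ⊗ y ≢ 0𝔽
  ⊗-≢0 x≢0 y≢0 = y≢0 ∘ integral x≢0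

  inv-≢0 : ∀ {x} → x ≢ 0𝔽 → inv x ≢ 0𝔽
  inv-≢0 {x} x≢0 eq = 1≢0 (begin
    1𝔽         ≡⟨ ⊗-inv x≢0 ⟨
    x ⊗ inv x  ≡⟨ cong (x ⊗_) eq ⟩
    x ⊗ 0𝔽     ≡⟨ R.zeroʳ x ⟩
    0𝔽         ∎)

  inv-involutive : ∀ x → inv (inv x) ≡ x
  inv-involutive x = case x Fin.≟ 0𝔽 of λ where
    (yes x≡0) → trans (cong (inv ∘ inv) x≡0) (trans (cong inv inv-0) (trans inv-0 (sym x≡0)))
    (no x≢0)  → begin
      inv (inv x)                  ≡⟨ ⊗-inv-⊗ (inv (inv x)) x≢0 ⟨
      x ⊗ (inv x ⊗ inv (inv x))    ≡⟨ cong (x ⊗_) (⊗-inv (inv-≢0 x≢0)) ⟩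
      x ⊗ 1𝔽                       ≡⟨ R.*-identityʳ x ⟩
      x                            ∎

  x⊖y≡0⇒x≡y : ∀ {x y} → x ⊖ y ≡ 0𝔽 → x ≡ y
  x⊖y≡0⇒x≡y {x} {y} = x∙y⁻¹≈ε⇒x≈y x y

  square-roots : ∀ {x y} → x ⊗ x ≡ y ⊗ y → x ≡ y ⊎ x ≡ ⊝ y
  square-roots {x} {y} eq with x ⊖ y Fin.≟ 0𝔽
  ... | yes x⊖y≡0 = inj₁ (x⊖y≡0⇒x≡y x⊖y≡0)
  ... | no  x⊖y≢0 = inj₂ (+-inverseˡ-unique x y (integral x⊖y≢0 (begin
    (x ⊕ ⊝ y) ⊗ (x ⊕ y)                    ≡⟨ solve 3 (λ x y z → (x :+ z) :* (x :+ y) := x :* x :+ z :* y :+ x :* (z :+ y)) refl x y (⊝ y) ⟩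
    x ⊗ x ⊕ ⊝ y ⊗ y ⊕ x ⊗ (⊝ y ⊕ y)        ≡⟨ cong₂ (λ a b → a ⊕ ⊝ y ⊗ y ⊕ x ⊗ b) eq (⊝-inverseˡ y) ⟩
    y ⊗ y ⊕ ⊝ y ⊗ y ⊕ x ⊗ 0𝔽               ≡⟨ cong₂ _⊕_ (cong (y ⊗ y ⊕_) (sym (-‿distribˡ-* y y))) (R.zeroʳ x) ⟩
    y ⊗ y ⊖ y ⊗ y ⊕ 0𝔽                     ≡⟨ R.+-identityʳ (y ⊗ y ⊖ y ⊗ y) ⟩
    y ⊗ y ⊖ y ⊗ y                          ≡⟨ R.-‿inverseʳ (y ⊗ y) ⟩
    0𝔽                                     ∎)))

  -- Values of χ, their sum and multiplicativity

  data χ-View (x : 𝔽 p) : Set where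
    isZero    : x ≡ 0𝔽 → χ x ≡ 0ℤ → χ-View x
    square    : x ≢ 0𝔽 → IsSquare x → χ x ≡ 1ℤ → χ-View x
    nonSquare : x ≢ 0𝔽 → ¬ IsSquare x → χ x ≡ -1ℤ → χ-View x

  χ-view : ∀ x → χ-View x
  χ-view x = view (x Fin.≟ 0𝔽) (isSquare? x) refl
    where
    -- With the two decisions as arguments, the nested conditional in `χ` computes as soon as they
    -- are matched.
    view : (z : Dec (x ≡ 0𝔽)) (s : Dec (IsSquare x)) →
      χ x ≡ (if does z then 0ℤ else if does s then 1ℤ else -1ℤ) → χ-View x
    view (yes x≡0) _       eq = isZero x≡0 eq
    view (no x≢0)  (yes s) eq = square x≢0 s eq
    view (no x≢0)  (no ¬s) eq = nonSquare x≢0 ¬s eq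

  χ-0 : χ (0𝔽 {p}) ≡ 0ℤ
  χ-0 with χ-view 0𝔽
  ... | isZero _ eq         = eq
  ... | square 0≢0 _ _      = contradiction refl 0≢0
  ... | nonSquare 0≢0 _ _   = contradiction refl 0≢0

  χ-square : ∀ {x} → x ≢ 0𝔽 → IsSquare x → χ x ≡ 1ℤ
  χ-square {x} x≢0 s with χ-view x
  ... | isZero x≡0 _        = contradiction x≡0 x≢0
  ... | square _ _ eq       = eq
  ... | nonSquare _ ¬s _    = contradiction s ¬s

  χ-nonSquare : ∀ {x} → x ≢ 0𝔽 → ¬ IsSquare x → χ x ≡ -1ℤ
  χ-nonSquare {x} x≢0 ¬s with χ-view x
  ... | isZero x≡0 _        = contradiction x≡0 x≢0
  ... | square _ s _        = contradiction s ¬s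
  ... | nonSquare _ _ eq    = eq

  χ-1 : χ (1𝔽 {p}) ≡ 1ℤ
  χ-1 = χ-square 1≢0 (1𝔽 , ⊗-identityˡ 1𝔽)

  χ≤1 : ∀ x → χ x ≤ 1ℤ
  χ≤1 x with χ-view x
  ... | isZero _ eq      = ℤ.≤-trans (ℤ.≤-reflexive eq) (+≤+ ℕ.z≤n)
  ... | square _ _ eq    = ℤ.≤-reflexive eq
  ... | nonSquare _ _ eq = ℤ.≤-trans (ℤ.≤-reflexive eq) -≤+

  χ-*-χ : ∀ {x} → x ≢ 0𝔽 → χ x * χ x ≡ 1ℤ
  χ-*-χ {x} x≢0 with χ-view x
  ... | isZero x≡0 _     = contradiction x≡0 x≢0
  ... | square _ _ eq    = cong₂ _*_ eq eq
  ... | nonSquare _ _ eq = cong₂ _*_ eq eq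

  χ-±1 : ∀ {x} → x ≢ 0𝔽 → IsPlusMinusOne (χ x)
  χ-±1 {x} x≢0 with χ-view x
  ... | isZero x≡0 _     = contradiction x≡0 x≢0
  ... | square _ _ eq    = inj₁ eq
  ... | nonSquare _ _ eq = inj₂ eq

  -- The roots are 0 alone, c and -c, or none. In the second case c ≠ -c because 2 ≠ 0.
  sum-square-roots : ∀ x → sum (λ y → 𝟙 (y ⊗ y Fin.≟ x)) ≡ 1ℤ + χ x
  sum-square-roots x with χ-view x
  ... | isZero x≡0 eq = begin
    sum (λ y → 𝟙 (y ⊗ y Fin.≟ x))   ≡⟨ sum-cong-≗ (λ y → 𝟙-cong (y ⊗ y Fin.≟ x) (y Fin.≟ 0𝔽) (to y) from) ⟩
    sum (λ y → 𝟙 (y Fin.≟ 0𝔽))      ≡⟨ sum≡ (sum-𝟙 0𝔽) ⟩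
    1ℤ + 0ℤ                         ≡⟨ cong (λ s → 1ℤ + s) eq ⟨
    1ℤ + χ x                        ∎
    where
    to : ∀ y → y ⊗ y ≡ x → y ≡ 0𝔽
    to y yy≡x with y Fin.≟ 0𝔽
    ... | yes y≡0 = y≡0
    ... | no  y≢0 = integral y≢0 (trans yy≡x x≡0)
    from : ∀ {y} → y ≡ 0𝔽 → y ⊗ y ≡ x
    from refl = trans (R.zeroˡ 0𝔽) (sym x≡0)
  ... | nonSquare _ ¬s eq = trans (sum-0 (λ y → 𝟙-no (y ⊗ y Fin.≟ x) (λ yy≡x → ¬s (y , yy≡x)))) (cong (λ s → 1ℤ + s) (sym eq))
  ... | square x≢0 (c , cc≡x) eq = begin
    sum (λ y → 𝟙 (y ⊗ y Fin.≟ x))                    ≡⟨ sum-cong-≗ split ⟩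
    sum (λ y → 𝟙 (y Fin.≟ c) + 𝟙 (y Fin.≟ ⊝ c))      ≡⟨ sum≡ (sum-𝟙 c +ˢ sum-𝟙 (⊝ c)) ⟩
    1ℤ + 1ℤ                                          ≡⟨ cong (λ s → 1ℤ + s) eq ⟨
    1ℤ + χ x                                         ∎
    where
    c≢0 : c ≢ 0𝔽
    c≢0 refl = x≢0 (trans (sym cc≡x) (R.zeroˡ 0𝔽))

    c≢⊝c : c ≢ ⊝ c
    c≢⊝c c≡⊝c = c≢0 (integral 2≢0 (begin
      2𝔽 ⊗ c                ≡⟨ ⊗-distribʳ-⊕ c 1𝔽 1𝔽 ⟩
      1𝔽 ⊗ c ⊕ 1𝔽 ⊗ c       ≡⟨ cong₂ _⊕_ (trans (⊗-identityˡ c) c≡⊝c) (⊗-identityˡ c) ⟩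
      ⊝ c ⊕ c               ≡⟨ ⊝-inverseˡ c ⟩
      0𝔽                    ∎))

    ⊝c-root : ⊝ c ⊗ ⊝ c ≡ x
    ⊝c-root = begin
      ⊝ c ⊗ ⊝ c      ≡⟨ -‿distribˡ-* c (⊝ c) ⟨
      ⊝ (c ⊗ ⊝ c)    ≡⟨ cong ⊝_ (-‿distribʳ-* c c) ⟨
      ⊝ ⊝ (c ⊗ c)    ≡⟨ -‿involutive (c ⊗ c) ⟩
      c ⊗ c          ≡⟨ cc≡x ⟩
      x              ∎

    split : ∀ y → 𝟙 (y ⊗ y Fin.≟ x) ≡ 𝟙 (y Fin.≟ c) + 𝟙 (y Fin.≟ ⊝ c)
    split y with y Fin.≟ c | y Fin.≟ ⊝ c
    ... | yes y≡c  | yes y≡⊝c = contradiction (trans (sym y≡c) y≡⊝c) c≢⊝c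
    ... | yes refl | no _     = 𝟙-yes (y ⊗ y Fin.≟ x) cc≡x
    ... | no _     | yes refl = 𝟙-yes (y ⊗ y Fin.≟ x) ⊝c-root
    ... | no y≢c   | no y≢⊝c  = 𝟙-no (y ⊗ y Fin.≟ x) λ yy≡x → [ y≢c , y≢⊝c ]′ (square-roots (trans yy≡x (sym cc≡x)))

  -- Pairs (x, y) with y² = x are counted twice: by x there are p + Σ χ of them, by y there are p,
  -- as each y has one square.
  sum-χ : χ {p} HasSum 0ℤ
  sum-χ = hasSum (+-cancelˡ (+ p) (sum χ) 0ℤ (begin
    + p + sum χ                                            ≡⟨ sum≡ (sum-1 p +ˢ hasSum {f = χ} refl) ⟨
    sum (λ x → 1ℤ + χ x)                                   ≡⟨ sum-cong-≗ sum-square-roots ⟨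
    sum (λ (x : 𝔽 p) → sum (λ y → 𝟙 (y ⊗ y Fin.≟ x)))      ≡⟨ ∑-comm {p} {p} (λ x y → 𝟙 (y ⊗ y Fin.≟ x)) ⟩
    sum (λ (y : 𝔽 p) → sum (λ x → 𝟙 (y ⊗ y Fin.≟ x)))
      ≡⟨ sum-cong-≗ {p} (λ y → trans (sum-cong-≗ (λ x → 𝟙-cong (y ⊗ y Fin.≟ x) (x Fin.≟ y ⊗ y) sym sym)) (sum≡ (sum-𝟙 (y ⊗ y)))) ⟩
    sum {p} (λ _ → 1ℤ)                                     ≡⟨ sum≡ (sum-1 p) ⟩
    + p                                                    ≡⟨ ℤ.+-identityʳ (+ p) ⟨
    + p + 0ℤ                                               ∎))

  sum-⊗ : ∀ {a} → a ≢ 0𝔽 → (f : 𝔽 p → ℤ) → sum (λ x → f (a ⊗ x)) ≡ sum f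
  sum-⊗ {a} a≢0 = sum-bijection (a ⊗_) (inv a ⊗_) (λ x → ⊗-inv-⊗ x a≢0) (λ x → inv-⊗-⊗ x a≢0)

  sum-⊕ : ∀ a (f : 𝔽 p → ℤ) → sum (λ x → f (x ⊕ a)) ≡ sum f
  sum-⊕ a = sum-bijection (_⊕ a) (_⊖ a) (λ x → cancel x (⊝-inverseˡ a)) (λ x → cancel x (R.-‿inverseʳ a))
    where
    cancel : ∀ x {b c} → b ⊕ c ≡ 0𝔽 → x ⊕ b ⊕ c ≡ x
    cancel x {b} {c} eq = trans (⊕-assoc x b c) (trans (cong (x ⊕_) eq) (R.+-identityʳ x))

  χ-square-⊗ : ∀ {c} → c ≢ 0𝔽 → ∀ x → χ (c ⊗ c ⊗ x) ≡ χ x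
  χ-square-⊗ {c} c≢0 x with χ-view x
  ... | isZero refl _ = cong χ (R.zeroʳ (c ⊗ c))
  ... | square x≢0 (d , dd≡x) eq = trans (χ-square (⊗-≢0 (⊗-≢0 c≢0 c≢0) x≢0) (c ⊗ d , (begin
    c ⊗ d ⊗ (c ⊗ d)    ≡⟨ solve 2 (λ c d → c :* d :* (c :* d) := c :* c :* (d :* d)) refl c d ⟩
    c ⊗ c ⊗ (d ⊗ d)    ≡⟨ cong (c ⊗ c ⊗_) dd≡x ⟩
    c ⊗ c ⊗ x          ∎))) (sym eq)
  ... | nonSquare x≢0 ¬s eq = trans (χ-nonSquare (⊗-≢0 (⊗-≢0 c≢0 c≢0) x≢0) λ (e , ee≡ccx) → ¬s (inv c ⊗ e , (begin
    inv c ⊗ e ⊗ (inv c ⊗ e)        ≡⟨ solve 2 (λ i e → i :* e :* (i :* e) := i :* (i :* (e :* e))) refl (inv c) e ⟩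
    inv c ⊗ (inv c ⊗ (e ⊗ e))      ≡⟨ cong (λ z → inv c ⊗ (inv c ⊗ z)) (trans ee≡ccx (⊗-assoc c c x)) ⟩
    inv c ⊗ (inv c ⊗ (c ⊗ (c ⊗ x))) ≡⟨ cong (inv c ⊗_) (inv-⊗-⊗ (c ⊗ x) c≢0) ⟩
    inv c ⊗ (c ⊗ x)                ≡⟨ inv-⊗-⊗ x c≢0 ⟩
    x                              ∎))) (sym eq)

  -- For a non-square a, χ(ax) ≤ −χ(x) holds for every x and both sides sum to 0, so equality holds throughout.
  χ-⊗ : ∀ a x → χ (a ⊗ x) ≡ χ a * χ x
  χ-⊗ a x with χ-view a
  ... | isZero refl eq = begin
    χ (0𝔽 ⊗ x)   ≡⟨ cong χ (R.zeroˡ x) ⟩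
    χ 0𝔽         ≡⟨ χ-0 ⟩
    0ℤ           ≡⟨ ℤ.*-zeroˡ (χ x) ⟨
    0ℤ * χ x     ≡⟨ cong (_* χ x) eq ⟨
    χ a * χ x    ∎
  ... | square a≢0 (c , refl) eq = begin
    χ (c ⊗ c ⊗ x)   ≡⟨ χ-square-⊗ {c} (λ { refl → a≢0 (R.zeroˡ 0𝔽) }) x ⟩
    χ x             ≡⟨ ℤ.*-identityˡ (χ x) ⟨
    1ℤ * χ x        ≡⟨ cong (_* χ x) eq ⟨
    χ a * χ x       ∎
  ... | nonSquare a≢0 _ eq = trans
      (sum-≤-antisym bound (trans (sum-⊗ a≢0 χ) (trans (sum≡ sum-χ) (sym (sum≡ (-1ℤ *ˢ sum-χ))))) x)
      (cong (_* χ x) (sym eq))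
    where
    bound : ∀ y → χ (a ⊗ y) ≤ -1ℤ * χ y
    bound y with χ-view y
    ... | isZero refl eq₀ = ℤ.≤-reflexive (trans (trans (cong χ (R.zeroʳ a)) χ-0) (cong (-1ℤ *_) (sym eq₀)))
    ... | square y≢0 (d , refl) eq₁ = ℤ.≤-reflexive (begin
      χ (a ⊗ (d ⊗ d))   ≡⟨ cong χ (⊗-comm a (d ⊗ d)) ⟩
      χ (d ⊗ d ⊗ a)     ≡⟨ χ-square-⊗ {d} (λ { refl → y≢0 (R.zeroˡ 0𝔽) }) a ⟩
      χ a               ≡⟨ eq ⟩
      -1ℤ * 1ℤ          ≡⟨ cong (-1ℤ *_) eq₁ ⟨
      -1ℤ * χ (d ⊗ d)   ∎)
    ... | nonSquare _ _ eq₂ = ℤ.≤-trans (χ≤1 (a ⊗ y)) (ℤ.≤-reflexive (cong (-1ℤ *_) (sym eq₂)))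

  -- Sums of shifted values and of products of two values

  sum-χ⊕ : ∀ a → (λ n → χ (n ⊕ a)) HasSum 0ℤ
  sum-χ⊕ a = hasSum (trans (sum-⊕ a χ) (sum≡ sum-χ))

  -- For n ≠ 0, χ(n) χ(n + a) = χ(n² (1 + a/n)) = χ(1 + a/n), and 1 + a/n takes every value except 1.
  sum-χ-χ : ∀ {a} → a ≢ 0𝔽 → (λ n → χ n * χ (n ⊕ a)) HasSum -1ℤ
  sum-χ-χ {a} a≢0 = sum-resp-≗ (λ n → split n (n Fin.≟ 0𝔽)) (hasSum sum-χ[1+a/n] +ˢ -1ℤ *ˢ sum-𝟙 0𝔽)
    where
    sum-χ[1+a/n] : sum (λ n → χ (a ⊗ inv n ⊕ 1𝔽)) ≡ 0ℤ
    sum-χ[1+a/n] = begin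
      sum (λ n → χ (a ⊗ inv n ⊕ 1𝔽))  ≡⟨ sum-bijection inv inv inv-involutive inv-involutive (λ n → χ (a ⊗ n ⊕ 1𝔽)) ⟩
      sum (λ n → χ (a ⊗ n ⊕ 1𝔽))      ≡⟨ sum-⊗ a≢0 (λ n → χ (n ⊕ 1𝔽)) ⟩
      sum (λ n → χ (n ⊕ 1𝔽))          ≡⟨ sum≡ (sum-χ⊕ 1𝔽) ⟩
      0ℤ                              ∎

    -- Since `inv 0𝔽` is 0, the full sum of χ(1 + a/n) includes the term χ(1) = 1 at n = 0; the
    -- indicator in `split` takes it out again and leaves -1.
    a⊗inv0⊕1≡1 : a ⊗ inv 0𝔽 ⊕ 1𝔽 ≡ 1𝔽
    a⊗inv0⊕1≡1 = begin
      a ⊗ inv 0𝔽 ⊕ 1𝔽  ≡⟨ cong (λ z → a ⊗ z ⊕ 1𝔽) inv-0 ⟩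
      a ⊗ 0𝔽 ⊕ 1𝔽      ≡⟨ cong (_⊕ 1𝔽) (R.zeroʳ a) ⟩
      0𝔽 ⊕ 1𝔽          ≡⟨ ⊕-identityˡ 1𝔽 ⟩
      1𝔽               ∎

    factor : ∀ {n} → n ≢ 0𝔽 → n ⊕ a ≡ n ⊗ (a ⊗ inv n ⊕ 1𝔽)
    factor {n} n≢0 = begin
      n ⊕ a                          ≡⟨ ⊕-comm n a ⟩
      a ⊕ n                          ≡⟨ cong₂ _⊕_ (⊗-inv-⊗ a n≢0) (R.*-identityʳ n) ⟨
      n ⊗ (inv n ⊗ a) ⊕ n ⊗ 1𝔽       ≡⟨ cong (λ z → n ⊗ z ⊕ n ⊗ 1𝔽) (⊗-comm (inv n) a) ⟩
      n ⊗ (a ⊗ inv n) ⊕ n ⊗ 1𝔽       ≡⟨ R.distribˡ n (a ⊗ inv n) 1𝔽 ⟨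
      n ⊗ (a ⊗ inv n ⊕ 1𝔽)           ∎

    split : ∀ n → Dec (n ≡ 0𝔽) → χ n * χ (n ⊕ a) ≡ χ (a ⊗ inv n ⊕ 1𝔽) + -1ℤ * 𝟙 (n Fin.≟ 0𝔽)
    split n (yes refl) = begin
      χ 0𝔽 * χ (0𝔽 ⊕ a)                              ≡⟨ cong (_* χ (0𝔽 ⊕ a)) χ-0 ⟩
      0ℤ * χ (0𝔽 ⊕ a)                                ≡⟨ ℤ.*-zeroˡ (χ (0𝔽 ⊕ a)) ⟩
      1ℤ + -1ℤ * 1ℤ                                  ≡⟨ cong₂ (λ u v → u + -1ℤ * v) χ-1 (𝟙-yes (0𝔽 Fin.≟ 0𝔽) refl) ⟨
      χ 1𝔽 + -1ℤ * 𝟙 (0𝔽 Fin.≟ 0𝔽)                   ≡⟨ cong (λ u → χ u + -1ℤ * 𝟙 (0𝔽 Fin.≟ 0𝔽)) a⊗inv0⊕1≡1 ⟨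
      χ (a ⊗ inv 0𝔽 ⊕ 1𝔽) + -1ℤ * 𝟙 (0𝔽 Fin.≟ 0𝔽)    ∎
    split n (no n≢0) = begin
      χ n * χ (n ⊕ a)                                ≡⟨ cong (λ u → χ n * χ u) (factor n≢0) ⟩
      χ n * χ (n ⊗ (a ⊗ inv n ⊕ 1𝔽))                 ≡⟨ cong (χ n *_) (χ-⊗ n (a ⊗ inv n ⊕ 1𝔽)) ⟩
      χ n * (χ n * χ (a ⊗ inv n ⊕ 1𝔽))               ≡⟨ ℤ.*-assoc (χ n) (χ n) (χ (a ⊗ inv n ⊕ 1𝔽)) ⟨
      χ n * χ n * χ (a ⊗ inv n ⊕ 1𝔽)                 ≡⟨ cong (_* χ (a ⊗ inv n ⊕ 1𝔽)) (χ-*-χ n≢0) ⟩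
      1ℤ * χ (a ⊗ inv n ⊕ 1𝔽)                        ≡⟨ ℤ.*-identityˡ (χ (a ⊗ inv n ⊕ 1𝔽)) ⟩
      χ (a ⊗ inv n ⊕ 1𝔽)                             ≡⟨ ℤ.+-identityʳ (χ (a ⊗ inv n ⊕ 1𝔽)) ⟨
      χ (a ⊗ inv n ⊕ 1𝔽) + -1ℤ * 0ℤ                  ≡⟨ cong (λ v → χ (a ⊗ inv n ⊕ 1𝔽) + -1ℤ * v) (𝟙-no (n Fin.≟ 0𝔽) n≢0) ⟨
      χ (a ⊗ inv n ⊕ 1𝔽) + -1ℤ * 𝟙 (n Fin.≟ 0𝔽)      ∎

  -- Doubled in order to stay in ℤ. The last term acts only at x = 0, where 1 + ε χ(x) would give 1
  -- although χ(x) ≠ ε.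
  2*𝟙[χ≡ε] : ∀ {ε} → IsPlusMinusOne ε → ∀ x → + 2 * 𝟙 (χ x ℤ.≟ ε) ≡ 1ℤ + ε * χ x + -1ℤ * 𝟙 (x Fin.≟ 0𝔽)
  2*𝟙[χ≡ε] ±ε x with χ-view x
  2*𝟙[χ≡ε] (inj₁ refl) x | isZero x≡0 eq rewrite eq | 𝟙-yes (x Fin.≟ 0𝔽) x≡0 = refl
  2*𝟙[χ≡ε] (inj₂ refl) x | isZero x≡0 eq rewrite eq | 𝟙-yes (x Fin.≟ 0𝔽) x≡0 = refl
  2*𝟙[χ≡ε] (inj₁ refl) x | square x≢0 _ eq rewrite eq | 𝟙-no (x Fin.≟ 0𝔽) x≢0 = refl
  2*𝟙[χ≡ε] (inj₂ refl) x | square x≢0 _ eq rewrite eq | 𝟙-no (x Fin.≟ 0𝔽) x≢0 = refl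
  2*𝟙[χ≡ε] (inj₁ refl) x | nonSquare x≢0 _ eq rewrite eq | 𝟙-no (x Fin.≟ 0𝔽) x≢0 = refl
  2*𝟙[χ≡ε] (inj₂ refl) x | nonSquare x≢0 _ eq rewrite eq | 𝟙-no (x Fin.≟ 0𝔽) x≢0 = refl

  -- In use x is an expression in n that vanishes exactly at n = c. Moving the correction to n = c
  -- gives it the form that `sum-𝟙-*` evaluates.
  2*𝟙[χ≡ε]-at : ∀ {ε} → IsPlusMinusOne ε → ∀ x {n : 𝔽 p} c → (x ≡ 0𝔽 → n ≡ c) → (n ≡ c → x ≡ 0𝔽) →
    + 2 * 𝟙 (χ x ℤ.≟ ε) ≡ 1ℤ + ε * χ x + -1ℤ * 𝟙 (n Fin.≟ c)
  2*𝟙[χ≡ε]-at {ε} ±ε x {n} c to from = trans (2*𝟙[χ≡ε] ±ε x)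
    (cong (λ u → 1ℤ + ε * χ x + -1ℤ * u) (𝟙-cong (x Fin.≟ 0𝔽) (n Fin.≟ c) to from))

  -- The values χ(-1) and χ(2)

  ⊝-≡0 : ∀ {x} → ⊝ x ≡ 0𝔽 → x ≡ 0𝔽
  ⊝-≡0 {x} eq = trans (sym (-‿involutive x)) (trans (cong ⊝_ eq) -0#≈0#)

  ⊝1≢0 : ⊝ 1𝔽 ≢ 0𝔽
  ⊝1≢0 = 1≢0 ∘ ⊝-≡0

  χ-⊝ : ∀ x → χ (⊝ x) ≡ χ (⊝ 1𝔽) * χ x
  χ-⊝ x = trans (cong χ (sym (-1*x≈-x x))) (χ-⊗ (⊝ 1𝔽) x)

  -- χ(x) χ(1/x) = χ(1) = 1, and χ(x) is its own inverse.
  χ-inv : ∀ {x} → x ≢ 0𝔽 → χ (inv x) ≡ χ x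
  χ-inv {x} x≢0 = begin
    χ (inv x)                   ≡⟨ ℤ.*-identityˡ (χ (inv x)) ⟨
    1ℤ * χ (inv x)              ≡⟨ cong (_* χ (inv x)) (χ-*-χ x≢0) ⟨
    χ x * χ x * χ (inv x)       ≡⟨ ℤ.*-assoc (χ x) (χ x) (χ (inv x)) ⟩
    χ x * (χ x * χ (inv x))     ≡⟨ cong (χ x *_) (χ-⊗ x (inv x)) ⟨
    χ x * χ (x ⊗ inv x)         ≡⟨ cong (λ u → χ x * χ u) (⊗-inv x≢0) ⟩
    χ x * χ 1𝔽                  ≡⟨ cong (χ x *_) χ-1 ⟩
    χ x * 1ℤ                    ≡⟨ ℤ.*-identityʳ (χ x) ⟩
    χ x                         ∎

  n⊕1≡0⇒n≡⊝1 : ∀ {n} → n ⊕ 1𝔽 ≡ 0𝔽 → n ≡ ⊝ 1𝔽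
  n⊕1≡0⇒n≡⊝1 {n} = +-inverseˡ-unique n 1𝔽

  ⊝[n⊕1]⊕1≡⊝n : ∀ n → ⊝ (n ⊕ 1𝔽) ⊕ 1𝔽 ≡ ⊝ n
  ⊝[n⊕1]⊕1≡⊝n n = begin
    ⊝ (n ⊕ 1𝔽) ⊕ 1𝔽     ≡⟨ cong (_⊕ 1𝔽) (-‿+-comm n 1𝔽) ⟨
    ⊝ n ⊕ ⊝ 1𝔽 ⊕ 1𝔽     ≡⟨ ⊕-assoc (⊝ n) (⊝ 1𝔽) 1𝔽 ⟩
    ⊝ n ⊕ (⊝ 1𝔽 ⊕ 1𝔽)   ≡⟨ cong (⊝ n ⊕_) (⊝-inverseˡ 1𝔽) ⟩
    ⊝ n ⊕ 0𝔽            ≡⟨ R.+-identityʳ (⊝ n) ⟩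
    ⊝ n                 ∎

  ½ : 𝔽 p
  ½ = inv 2𝔽

  2⊗ : ∀ x → 2𝔽 ⊗ x ≡ x ⊕ x
  2⊗ x = trans (⊗-distribʳ-⊕ x 1𝔽 1𝔽) (cong₂ _⊕_ (⊗-identityˡ x) (⊗-identityˡ x))

  x⊕x≡1⇒x≡½ : ∀ {x} → x ⊕ x ≡ 1𝔽 → x ≡ ½
  x⊕x≡1⇒x≡½ {x} eq = begin
    x               ≡⟨ inv-⊗-⊗ x 2≢0 ⟨
    ½ ⊗ (2𝔽 ⊗ x)    ≡⟨ cong (½ ⊗_) (trans (2⊗ x) eq) ⟩
    ½ ⊗ 1𝔽          ≡⟨ R.*-identityʳ ½ ⟩
    ½               ∎

  ⊝½⊕1≡½ : ⊝ ½ ⊕ 1𝔽 ≡ ½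
  ⊝½⊕1≡½ = begin
    ⊝ ½ ⊕ 1𝔽         ≡⟨ cong (⊝ ½ ⊕_) (trans (sym (2⊗ ½)) (⊗-inv 2≢0)) ⟨
    ⊝ ½ ⊕ (½ ⊕ ½)    ≡⟨ ⊕-assoc (⊝ ½) ½ ½ ⟨
    ⊝ ½ ⊕ ½ ⊕ ½      ≡⟨ cong (_⊕ ½) (⊝-inverseˡ ½) ⟩
    0𝔽 ⊕ ½           ≡⟨ ⊕-identityˡ ½ ⟩
    ½                ∎

  p≡6+χ[-1]+2χ[2] : ∃ λ k → + p ≡ + 6 + χ (⊝ 1𝔽) + + 2 * χ 2𝔽 + + 8 * k
  p≡6+χ[-1]+2χ[2] = k , combine (+ p) s (χ 2𝔽) (sum f) k (f (⊝ ½)) 4M M-parity 2f[-½]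
    where
    s : ℤ
    s = χ (⊝ 1𝔽)

    f A B : 𝔽 p → ℤ
    f n = 𝟙 (χ (⊝ n) ℤ.≟ 1ℤ) * 𝟙 (χ (n ⊕ 1𝔽) ℤ.≟ 1ℤ)
    A n = 1ℤ + 1ℤ * χ (⊝ n)
    B n = 1ℤ + 1ℤ * χ (n ⊕ 1𝔽)

    4f : ∀ n → + 4 * f n ≡ A n * B n + -1ℤ * (𝟙 (n Fin.≟ 0𝔽) * B n) + -1ℤ * (𝟙 (n Fin.≟ ⊝ 1𝔽) * A n)
    4f n = expand₂ {A n} {B n} {d = 𝟙 (n Fin.≟ 0𝔽)} {𝟙 (n Fin.≟ ⊝ 1𝔽)}
                   (2*𝟙[χ≡ε]-at (inj₁ refl) (⊝ n) 0𝔽 (⊝-≡0 {n}) (λ { refl → -0#≈0# }))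
                   (2*𝟙[χ≡ε]-at (inj₁ refl) (n ⊕ 1𝔽) (⊝ 1𝔽) n⊕1≡0⇒n≡⊝1 (λ { refl → ⊝-inverseˡ 1𝔽 }))
                   (𝟙-disjoint (n Fin.≟ 0𝔽) (n Fin.≟ ⊝ 1𝔽) (λ n≡0 n≡⊝1 → ⊝1≢0 (trans (sym n≡⊝1) n≡0)))

    -- χ(-n) = χ(-1) χ(n) reduces the mixed term to `sum-χ-χ`. The zero summands stay as the
    -- combinators produce them until the ring solver clears them in `combine`.
    sum-AB : (λ n → A n * B n) HasSum + p + s * 0ℤ + 0ℤ + s * -1ℤ
    sum-AB = sum-resp-≗ (λ n → trans (cong (λ u → (1ℤ + 1ℤ * u) * B n) (χ-⊝ n)) (multiply s (χ n) (χ (n ⊕ 1𝔽))))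
      (sum-1 p +ˢ s *ˢ sum-χ +ˢ sum-χ⊕ 1𝔽 +ˢ s *ˢ sum-χ-χ 1≢0)
      where
      multiply : ∀ s c y → (1ℤ + 1ℤ * (s * c)) * (1ℤ + 1ℤ * y) ≡ 1ℤ + s * c + y + s * (c * y)
      multiply = solve-∀

    -- At each of the points n = 0 and n = -1 the other argument is 1, so each correction takes 2
    -- from 4M: together the 4 in p - 4 - χ(-1).
    B[0] : B 0𝔽 ≡ + 2
    B[0] = cong (λ u → 1ℤ + 1ℤ * u) (trans (cong χ (⊕-identityˡ 1𝔽)) χ-1)

    A[-1] : A (⊝ 1𝔽) ≡ + 2
    A[-1] = cong (λ u → 1ℤ + 1ℤ * u) (trans (cong χ (-‿involutive 1𝔽)) χ-1)

    4M : + 4 * sum f ≡ + p + s * 0ℤ + 0ℤ + s * -1ℤ + -1ℤ * + 2 + -1ℤ * + 2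
    4M = begin
      + 4 * sum f                    ≡⟨ sum≡ (+ 4 *ˢ hasSum {f = f} refl) ⟨
      sum (λ n → + 4 * f n)          ≡⟨ sum≡ (sum-resp-≗ 4f (sum-AB +ˢ -1ℤ *ˢ sum-𝟙-* 0𝔽 B +ˢ -1ℤ *ˢ sum-𝟙-* (⊝ 1𝔽) A)) ⟩
      + p + s * 0ℤ + 0ℤ + s * -1ℤ + -1ℤ * B 0𝔽 + -1ℤ * A (⊝ 1𝔽)
                                     ≡⟨ cong₂ (λ u v → + p + s * 0ℤ + 0ℤ + s * -1ℤ + -1ℤ * u + -1ℤ * v) B[0] A[-1] ⟩
      + p + s * 0ℤ + 0ℤ + s * -1ℤ + -1ℤ * + 2 + -1ℤ * + 2 ∎

    -- -σ(n) = n + 1 and σ(n) + 1 = -n, so the two factors of `f` change places.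
    σ : 𝔽 p → 𝔽 p
    σ n = ⊝ (n ⊕ 1𝔽)

    f∘σ : ∀ n → f (σ n) ≡ f n
    f∘σ n = trans
      (cong₂ (λ u v → 𝟙 (χ u ℤ.≟ 1ℤ) * 𝟙 (χ v ℤ.≟ 1ℤ)) (-‿involutive (n ⊕ 1𝔽)) (⊝[n⊕1]⊕1≡⊝n n))
      (ℤ.*-comm (𝟙 (χ (n ⊕ 1𝔽) ℤ.≟ 1ℤ)) (𝟙 (χ (⊝ n) ℤ.≟ 1ℤ)))

    involution : ∃ λ k → sum f ≡ sum (λ n → 𝟙 (σ n Fin.≟ n) * f n) + + 2 * k
    involution = sum-involution σ (λ n → trans (cong ⊝_ (⊝[n⊕1]⊕1≡⊝n n)) (-‿involutive n)) f f∘σ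

    k : ℤ
    k = proj₁ involution

    fixed⇒-½ : ∀ {n} → σ n ≡ n → n ≡ ⊝ ½
    fixed⇒-½ {n} σn≡n = trans (sym (-‿involutive n)) (cong ⊝_ (x⊕x≡1⇒x≡½ {⊝ n} (begin
      ⊝ n ⊕ ⊝ n          ≡⟨ cong (⊝ n ⊕_) (trans (cong ⊝_ (sym σn≡n)) (-‿involutive (n ⊕ 1𝔽))) ⟩
      ⊝ n ⊕ (n ⊕ 1𝔽)     ≡⟨ ⊕-assoc (⊝ n) n 1𝔽 ⟨
      ⊝ n ⊕ n ⊕ 1𝔽       ≡⟨ cong (_⊕ 1𝔽) (⊝-inverseˡ n) ⟩
      0𝔽 ⊕ 1𝔽            ≡⟨ ⊕-identityˡ 1𝔽 ⟩
      1𝔽                 ∎)))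

    M-parity : sum f ≡ f (⊝ ½) + + 2 * k
    M-parity = trans (proj₂ involution) (cong (λ u → u + + 2 * k) (sum≡ (sum-resp-≗
      (λ n → cong (_* f n) (𝟙-cong (σ n Fin.≟ n) (n Fin.≟ ⊝ ½) fixed⇒-½ (λ { refl → cong ⊝_ ⊝½⊕1≡½ })))
      (sum-𝟙-* (⊝ ½) f))))

    2f[-½] : + 2 * f (⊝ ½) ≡ 1ℤ + 1ℤ * χ 2𝔽 + -1ℤ * 0ℤ
    2f[-½] = begin
      + 2 * f (⊝ ½)                                    ≡⟨ cong₂ (λ u v → + 2 * (𝟙 (χ u ℤ.≟ 1ℤ) * 𝟙 (χ v ℤ.≟ 1ℤ))) (-‿involutive ½) ⊝½⊕1≡½ ⟩
      + 2 * (𝟙 (χ ½ ℤ.≟ 1ℤ) * 𝟙 (χ ½ ℤ.≟ 1ℤ))          ≡⟨ cong (+ 2 *_) (𝟙-idem (χ ½ ℤ.≟ 1ℤ)) ⟩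
      + 2 * 𝟙 (χ ½ ℤ.≟ 1ℤ)                             ≡⟨ 2*𝟙[χ≡ε] (inj₁ refl) ½ ⟩
      1ℤ + 1ℤ * χ ½ + -1ℤ * 𝟙 (½ Fin.≟ 0𝔽)             ≡⟨ cong₂ (λ u v → 1ℤ + 1ℤ * u + -1ℤ * v) (χ-inv 2≢0) (𝟙-no (½ Fin.≟ 0𝔽) (inv-≢0 2≢0)) ⟩
      1ℤ + 1ℤ * χ 2𝔽 + -1ℤ * 0ℤ                        ∎

    -- 4M = P - s - 4 and M = h + 2k with 2h = 1 + t give P = 4 + s + 2(1 + t) + 8k.
    combine : ∀ P s t M k h → + 4 * M ≡ P + s * 0ℤ + 0ℤ + s * -1ℤ + -1ℤ * + 2 + -1ℤ * + 2 →
      M ≡ h + + 2 * k → + 2 * h ≡ 1ℤ + 1ℤ * t + -1ℤ * 0ℤ → P ≡ + 6 + s + + 2 * t + + 8 * k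
    combine P s t M k h eq₁ refl eq₃ = begin
      P                                         ≡⟨ step₁ P s ⟩
      P + s * 0ℤ + 0ℤ + s * -1ℤ + -1ℤ * + 2 + -1ℤ * + 2 + s + + 4
                                                ≡⟨ cong (λ u → u + s + + 4) eq₁ ⟨
      + 4 * (h + + 2 * k) + s + + 4             ≡⟨ step₂ h k s ⟩
      + 2 * (+ 2 * h) + s + + 4 + + 8 * k       ≡⟨ cong (λ u → + 2 * u + s + + 4 + + 8 * k) eq₃ ⟩
      + 2 * (1ℤ + 1ℤ * t + -1ℤ * 0ℤ) + s + + 4 + + 8 * k ≡⟨ step₃ s t k ⟩
      + 6 + s + + 2 * t + + 8 * k               ∎
      where
      step₁ : ∀ P s → P ≡ P + s * 0ℤ + 0ℤ + s * -1ℤ + -1ℤ * + 2 + -1ℤ * + 2 + s + + 4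
      step₁ = solve-∀
      step₂ : ∀ h k s → + 4 * (h + + 2 * k) + s + + 4 ≡ + 2 * (+ 2 * h) + s + + 4 + + 8 * k
      step₂ = solve-∀
      step₃ : ∀ s t k → + 2 * (1ℤ + 1ℤ * t + -1ℤ * 0ℤ) + s + + 4 + + 8 * k ≡ + 6 + s + + 2 * t + + 8 * k
      step₃ = solve-∀

  -- For a numeral r the implicit argument is found by evaluating `determines?`, that is, by
  -- checking the four sign pairs against r modulo 8.
  supplementary-laws : ∀ r s₀ t₀ {_ : True (determines? r s₀ t₀)} → p % 8 ≡ r → χ (⊝ 1𝔽) ≡ s₀ × χ 2𝔽 ≡ t₀
  supplementary-laws r s₀ t₀ {det} refl = lookup (toWitness det) (∈-signs (χ-±1 ⊝1≢0) (χ-±1 2≢0))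
    -- p = r + 8q and p = c + 8k give r - c = 8(k - q).
    (divides ∣ k - + q ∣ (trans (cong ∣_∣ r-c≡) (ℤ.abs-* (k - + q) (+ 8))))
    where
    q : ℕ
    q = p ℕ./ 8
    k c : ℤ
    k = proj₁ p≡6+χ[-1]+2χ[2]
    c = + 6 + χ (⊝ 1𝔽) + + 2 * χ 2𝔽
    p≡ : + (p % 8) + + q * + 8 ≡ c + + 8 * k
    p≡ = begin
      + (p % 8) + + q * + 8      ≡⟨ cong (λ u → + (p % 8) + u) (ℤ.pos-* q 8) ⟨
      + (p % 8 ℕ.+ q ℕ.* 8)      ≡⟨ cong +_ (m≡m%n+[m/n]*n p 8) ⟨
      + p                        ≡⟨ proj₂ p≡6+χ[-1]+2χ[2] ⟩
      c + + 8 * k                ∎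
    rearrange₁ : ∀ R q c → R - c ≡ R + q * + 8 - c - q * + 8
    rearrange₁ = solve-∀
    rearrange₂ : ∀ c k q → c + + 8 * k - c - q * + 8 ≡ (k - q) * + 8
    rearrange₂ = solve-∀
    r-c≡ : + (p % 8) - c ≡ (k - + q) * + 8
    r-c≡ = begin
      + (p % 8) - c                              ≡⟨ rearrange₁ (+ (p % 8)) (+ q) c ⟩
      + (p % 8) + + q * + 8 - c - + q * + 8      ≡⟨ cong (λ u → u - c - + q * + 8) p≡ ⟩
      c + + 8 * k - c - + q * + 8                ≡⟨ rearrange₂ c k (+ q) ⟩
      (k - + q) * + 8                            ∎

  -- The count of sign patterns

  ⊖1⊕ : ∀ n a → n ⊖ 1𝔽 ⊕ (1𝔽 ⊕ a) ≡ n ⊕ a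
  ⊖1⊕ n a = begin
    n ⊕ ⊝ 1𝔽 ⊕ (1𝔽 ⊕ a)      ≡⟨ solve 4 (λ n m u a → n :+ m :+ (u :+ a) := (m :+ u) :+ (n :+ a)) refl n (⊝ 1𝔽) 1𝔽 a ⟩
    ⊝ 1𝔽 ⊕ 1𝔽 ⊕ (n ⊕ a)      ≡⟨ cong (_⊕ (n ⊕ a)) (⊝-inverseˡ 1𝔽) ⟩
    0𝔽 ⊕ (n ⊕ a)             ≡⟨ ⊕-identityˡ (n ⊕ a) ⟩
    n ⊕ a                    ∎

  -- The factorisation x³ - x = (x - 1) x (x + 1) is what brings T_p into the count.
  χ-x³-x : ∀ x → χ (x ⊗ x ⊗ x ⊖ x) ≡ χ (x ⊖ 1𝔽) * χ x * χ (x ⊕ 1𝔽)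
  χ-x³-x x = begin
    χ (x ⊗ x ⊗ x ⊖ x)                    ≡⟨ cong χ factor ⟨
    χ ((x ⊖ 1𝔽) ⊗ x ⊗ (x ⊕ 1𝔽))          ≡⟨ χ-⊗ ((x ⊖ 1𝔽) ⊗ x) (x ⊕ 1𝔽) ⟩
    χ ((x ⊖ 1𝔽) ⊗ x) * χ (x ⊕ 1𝔽)        ≡⟨ cong (_* χ (x ⊕ 1𝔽)) (χ-⊗ (x ⊖ 1𝔽) x) ⟩
    χ (x ⊖ 1𝔽) * χ x * χ (x ⊕ 1𝔽)        ∎
    where
    factor : (x ⊖ 1𝔽) ⊗ x ⊗ (x ⊕ 1𝔽) ≡ x ⊗ x ⊗ x ⊖ x
    factor = begin
      (x ⊕ ⊝ 1𝔽) ⊗ x ⊗ (x ⊕ 1𝔽)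
        ≡⟨ solve 3 (λ x m u → (x :+ m) :* x :* (x :+ u) := x :* x :* x :+ m :* (x :* u) :+ x :* x :* (m :+ u)) refl x (⊝ 1𝔽) 1𝔽 ⟩
      x ⊗ x ⊗ x ⊕ ⊝ 1𝔽 ⊗ (x ⊗ 1𝔽) ⊕ x ⊗ x ⊗ (⊝ 1𝔽 ⊕ 1𝔽)
        ≡⟨ cong₂ (λ u v → x ⊗ x ⊗ x ⊕ u ⊕ x ⊗ x ⊗ v) (trans (-1*x≈-x (x ⊗ 1𝔽)) (cong ⊝_ (R.*-identityʳ x))) (⊝-inverseˡ 1𝔽) ⟩
      x ⊗ x ⊗ x ⊖ x ⊕ x ⊗ x ⊗ 0𝔽
        ≡⟨ cong (x ⊗ x ⊗ x ⊖ x ⊕_) (R.zeroʳ (x ⊗ x)) ⟩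
      x ⊗ x ⊗ x ⊖ x ⊕ 0𝔽
        ≡⟨ R.+-identityʳ (x ⊗ x ⊗ x ⊖ x) ⟩
      x ⊗ x ⊗ x ⊖ x ∎

  -- In terms of m = n - 1 the second argument is m + (1 + a), so `sum-χ-χ` applies with difference
  -- 1 + a. The cases a = 0 and a = 1 are used.
  sum-χ⊖1-χ⊕ : ∀ {a} → 1𝔽 ⊕ a ≢ 0𝔽 → (λ n → χ (n ⊖ 1𝔽) * χ (n ⊕ a)) HasSum -1ℤ
  sum-χ⊖1-χ⊕ {a} 1⊕a≢0 = sum-resp-≗ (λ n → cong (λ u → χ (n ⊖ 1𝔽) * χ u) (sym (⊖1⊕ n a)))
    (hasSum (trans (sum-⊕ (⊝ 1𝔽) (λ m → χ m * χ (m ⊕ (1𝔽 ⊕ a)))) (sum≡ (sum-χ-χ 1⊕a≢0))))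

  sum-χ⊖1-χ : (λ n → χ (n ⊖ 1𝔽) * χ n) HasSum -1ℤ
  sum-χ⊖1-χ = sum-resp-≗ (λ n → cong (λ u → χ (n ⊖ 1𝔽) * χ u) (sym (R.+-identityʳ n)))
    (sum-χ⊖1-χ⊕ (1≢0 ∘ trans (sym (R.+-identityʳ 1𝔽))))

  sum-χ⊖1-χ-χ⊕1 : (λ n → χ (n ⊖ 1𝔽) * χ n * χ (n ⊕ 1𝔽)) HasSum T p
  sum-χ⊖1-χ-χ⊕1 = sum-resp-≗ (λ n → sym (χ-x³-x n)) (hasSum refl)

  8N : ∀ {ε₁ ε₂ ε₃} → IsPlusMinusOne ε₁ → IsPlusMinusOne ε₂ → IsPlusMinusOne ε₃ →
    + 8 * + N p ε₁ ε₂ ε₃ ≡ 8N-formula (+ p) (χ (⊝ 1𝔽)) (χ 2𝔽) (T p) ε₁ ε₂ ε₃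
  8N {ε₁} {ε₂} {ε₃} ±ε₁ ±ε₂ ±ε₃ = begin
    + 8 * + N p ε₁ ε₂ ε₃
      ≡⟨ cong (+ 8 *_) (length-filter-tabulate (pattern? ε₁ ε₂ ε₃) {p} id) ⟩
    + 8 * sum (λ n → 𝟙 (pattern? ε₁ ε₂ ε₃ n))
      ≡⟨ sum≡ (+ 8 *ˢ hasSum {f = λ n → 𝟙 (pattern? ε₁ ε₂ ε₃ n)} refl) ⟨
    sum (λ n → + 8 * 𝟙 (pattern? ε₁ ε₂ ε₃ n))
      ≡⟨ sum≡ (sum-resp-≗ pointwise
           (sum-ABC +ˢ -1ℤ *ˢ sum-𝟙-* 1𝔽 (λ n → B n * C n) +ˢ -1ℤ *ˢ sum-𝟙-* 0𝔽 (λ n → A n * C n) +ˢ -1ℤ *ˢ sum-𝟙-* (⊝ 1𝔽) (λ n → A n * B n))) ⟩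
    total + -1ℤ * (B 1𝔽 * C 1𝔽) + -1ℤ * (A 0𝔽 * C 0𝔽) + -1ℤ * (A (⊝ 1𝔽) * B (⊝ 1𝔽))
      -- The two factors left at n = 1, 0, -1 have the arguments (1, 2), (-1, 1) and (-2, -1), so
      -- only χ(-1), χ(2) and their product χ(-2) appear.
      ≡⟨ cong₂ _+_ (cong₂ (λ u v → total + -1ℤ * ((1ℤ + ε₂ * u) * C 1𝔽) + -1ℤ * v) χ-1
           (cong₂ (λ u v → (1ℤ + ε₁ * u) * (1ℤ + ε₃ * v)) (cong χ (⊕-identityˡ (⊝ 1𝔽))) (trans (cong χ (⊕-identityˡ 1𝔽)) χ-1)))
           (cong (λ u → -1ℤ * ((1ℤ + ε₁ * u) * B (⊝ 1𝔽))) χ[-2]) ⟩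
    total + -1ℤ * ((1ℤ + ε₂ * 1ℤ) * (1ℤ + ε₃ * χ 2𝔽)) + -1ℤ * ((1ℤ + ε₁ * χ (⊝ 1𝔽)) * (1ℤ + ε₃ * 1ℤ))
      + -1ℤ * ((1ℤ + ε₁ * (χ (⊝ 1𝔽) * χ 2𝔽)) * (1ℤ + ε₂ * χ (⊝ 1𝔽)))
      ≡⟨ collect (+ p) (χ (⊝ 1𝔽)) (χ 2𝔽) (T p) ε₁ ε₂ ε₃ ⟩
    8N-formula (+ p) (χ (⊝ 1𝔽)) (χ 2𝔽) (T p) ε₁ ε₂ ε₃ ∎
    where
    A B C : 𝔽 p → ℤ
    A n = 1ℤ + ε₁ * χ (n ⊖ 1𝔽)
    B n = 1ℤ + ε₂ * χ n
    C n = 1ℤ + ε₃ * χ (n ⊕ 1𝔽)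

    -- One summand for each monomial of A B C, in the order of `multiply`; each pair gives -1
    -- because the differences 1, 1 and 2 are nonzero.
    total : ℤ
    total = + p + ε₁ * 0ℤ + ε₂ * 0ℤ + ε₃ * 0ℤ + ε₁ * ε₂ * -1ℤ + ε₂ * ε₃ * -1ℤ + ε₁ * ε₃ * -1ℤ + ε₁ * ε₂ * ε₃ * T p

    collect : ∀ P s t τ ε₁ ε₂ ε₃ →
      P + ε₁ * 0ℤ + ε₂ * 0ℤ + ε₃ * 0ℤ + ε₁ * ε₂ * -1ℤ + ε₂ * ε₃ * -1ℤ + ε₁ * ε₃ * -1ℤ + ε₁ * ε₂ * ε₃ * τ
      + -1ℤ * ((1ℤ + ε₂ * 1ℤ) * (1ℤ + ε₃ * t)) + -1ℤ * ((1ℤ + ε₁ * s) * (1ℤ + ε₃ * 1ℤ))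
      + -1ℤ * ((1ℤ + ε₁ * (s * t)) * (1ℤ + ε₂ * s)) ≡
      P - + 3 - (s + s * t) * ε₁ - (1ℤ + s) * ε₂ - (1ℤ + t) * ε₃
        - (1ℤ + s * s * t) * ε₁ * ε₂ - (1ℤ + s) * ε₁ * ε₃ - (1ℤ + t) * ε₂ * ε₃ + ε₁ * ε₂ * ε₃ * τ
    collect = solve-∀

    χ[-2] : χ (⊝ 1𝔽 ⊖ 1𝔽) ≡ χ (⊝ 1𝔽) * χ 2𝔽
    χ[-2] = trans (cong χ (-‿+-comm 1𝔽 1𝔽)) (χ-⊝ 2𝔽)

    1≢⊝1 : 1𝔽 ≢ ⊝ 1𝔽
    1≢⊝1 eq = 2≢0 (trans (cong (_⊕ 1𝔽) eq) (⊝-inverseˡ 1𝔽))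

    -- n - 1, n and n + 1 vanish at 1, 0 and -1. These are three distinct points, so all products of
    -- corrections disappear.
    pointwise : ∀ n → + 8 * 𝟙 (pattern? ε₁ ε₂ ε₃ n) ≡ A n * B n * C n
      + -1ℤ * (𝟙 (n Fin.≟ 1𝔽) * (B n * C n)) + -1ℤ * (𝟙 (n Fin.≟ 0𝔽) * (A n * C n)) + -1ℤ * (𝟙 (n Fin.≟ ⊝ 1𝔽) * (A n * B n))
    pointwise n = begin
      + 8 * 𝟙 (pattern? ε₁ ε₂ ε₃ n)
        ≡⟨ cong (+ 8 *_) (trans (𝟙-×-dec (χ (n ⊖ 1𝔽) ℤ.≟ ε₁) (χ n ℤ.≟ ε₂ ×-dec χ (n ⊕ 1𝔽) ℤ.≟ ε₃))
             (cong (𝟙 (χ (n ⊖ 1𝔽) ℤ.≟ ε₁) *_) (𝟙-×-dec (χ n ℤ.≟ ε₂) (χ (n ⊕ 1𝔽) ℤ.≟ ε₃)))) ⟩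
      + 8 * (𝟙 (χ (n ⊖ 1𝔽) ℤ.≟ ε₁) * (𝟙 (χ n ℤ.≟ ε₂) * 𝟙 (χ (n ⊕ 1𝔽) ℤ.≟ ε₃)))
        ≡⟨ expand₃ {A n} {B n} {C n} {d = 𝟙 (n Fin.≟ 1𝔽)} {𝟙 (n Fin.≟ 0𝔽)} {𝟙 (n Fin.≟ ⊝ 1𝔽)}
             (2*𝟙[χ≡ε]-at ±ε₁ (n ⊖ 1𝔽) 1𝔽 (x∙y⁻¹≈ε⇒x≈y n 1𝔽) (λ { refl → R.-‿inverseʳ 1𝔽 }))
             (2*𝟙[χ≡ε] ±ε₂ n)
             (2*𝟙[χ≡ε]-at ±ε₃ (n ⊕ 1𝔽) (⊝ 1𝔽) n⊕1≡0⇒n≡⊝1 (λ { refl → ⊝-inverseˡ 1𝔽 }))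
             (𝟙-disjoint (n Fin.≟ 1𝔽) (n Fin.≟ 0𝔽) (λ n≡1 n≡0 → 1≢0 (trans (sym n≡1) n≡0)))
             (𝟙-disjoint (n Fin.≟ 1𝔽) (n Fin.≟ ⊝ 1𝔽) (λ n≡1 n≡⊝1 → 1≢⊝1 (trans (sym n≡1) n≡⊝1)))
             (𝟙-disjoint (n Fin.≟ 0𝔽) (n Fin.≟ ⊝ 1𝔽) (λ n≡0 n≡⊝1 → ⊝1≢0 (trans (sym n≡⊝1) n≡0))) ⟩
      _ ∎

    sum-ABC : (λ n → A n * B n * C n) HasSum total
    sum-ABC = sum-resp-≗
      (λ n → multiply ε₁ ε₂ ε₃ (χ (n ⊖ 1𝔽)) (χ n) (χ (n ⊕ 1𝔽)))
      (sum-1 p +ˢ ε₁ *ˢ sum-χ⊕ (⊝ 1𝔽) +ˢ ε₂ *ˢ sum-χ +ˢ ε₃ *ˢ sum-χ⊕ 1𝔽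
        +ˢ (ε₁ * ε₂) *ˢ sum-χ⊖1-χ +ˢ (ε₂ * ε₃) *ˢ sum-χ-χ 1≢0 +ˢ (ε₁ * ε₃) *ˢ sum-χ⊖1-χ⊕ 2≢0
        +ˢ (ε₁ * ε₂ * ε₃) *ˢ sum-χ⊖1-χ-χ⊕1)
      where
      multiply : ∀ ε₁ ε₂ ε₃ x y z → (1ℤ + ε₁ * x) * (1ℤ + ε₂ * y) * (1ℤ + ε₃ * z) ≡
        1ℤ + ε₁ * x + ε₂ * y + ε₃ * z + ε₁ * ε₂ * (x * y) + ε₂ * ε₃ * (y * z) + ε₁ * ε₃ * (x * z) + ε₁ * ε₂ * ε₃ * (x * y * z)
      multiply = solve-∀

-- Division by 8 and the four residue classes

8*n≡E⇒n≡E/8 : ∀ n {E} → + 8 * + n ≡ E → + n / 1 ≡ E / 8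
-- `mkℚᵘ` stores the denominator minus one, so 0 and 7 stand for 1 and 8.
8*n≡E⇒n≡E/8 n {E} eq = ℚ.fromℚᵘ-cong {mkℚᵘ (+ n) 0} {mkℚᵘ E 7}
  (*≡* (trans (ℤ.*-comm (+ n) (+ 8)) (trans eq (sym (ℤ.*-identityʳ E)))))

theorem5 : (p : ℕ) .{{_ : NonZero p}} → Prime p → 2 ∤ p →
    (ε₁ ε₂ ε₃ : ℤ) → IsPlusMinusOne ε₁ → IsPlusMinusOne ε₂ → IsPlusMinusOne ε₃ →
    (p % 8 ≡ 1 →
    + N p ε₁ ε₂ ε₃ / 1 ≡
    (+ p - + 3 - + 2 * ε₁ - + 2 * ε₂ - + 2 * ε₃ - + 2 * ε₁ * ε₂ - + 2 * ε₁ * ε₃ - + 2 * ε₂ * ε₃ + ε₁ * ε₂ * ε₃ * T p) / 8)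
    × (p % 8 ≡ 3 →
    + N p ε₁ ε₂ ε₃ / 1 ≡
    (+ p - + 3 + ε₁ * ε₂ * ε₃ * T p) / 8)
    × (p % 8 ≡ 5 →
    + N p ε₁ ε₂ ε₃ / 1 ≡
    (+ p - + 3 - + 2 * ε₂ - + 2 * ε₁ * ε₃ + ε₁ * ε₂ * ε₃ * T p) / 8)
    × (p % 8 ≡ 7 →
    + N p ε₁ ε₂ ε₃ / 1 ≡
    (+ p - + 3 + + 2 * ε₁ - + 2 * ε₃ - + 2 * ε₁ * ε₂ - + 2 * ε₂ * ε₃ + ε₁ * ε₂ * ε₃ * T p) / 8)
theorem5 p pr 2∤p ε₁ ε₂ ε₃ ±ε₁ ±ε₂ ±ε₃ =
    -- For the signs (1, 1) all six coefficients evaluate to 2, so the formula is the claim by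
    -- computation. In the other cases terms with coefficient 0 have to be removed.
    (λ p%8≡1 → conclude (supplementary-laws 1 1ℤ 1ℤ p%8≡1) refl)
  , (λ p%8≡3 → conclude (supplementary-laws 3 -1ℤ -1ℤ p%8≡3) (case₃ (+ p) (T p) ε₁ ε₂ ε₃))
  , (λ p%8≡5 → conclude (supplementary-laws 5 1ℤ -1ℤ p%8≡5) (case₅ (+ p) (T p) ε₁ ε₂ ε₃))
  , (λ p%8≡7 → conclude (supplementary-laws 7 -1ℤ 1ℤ p%8≡7) (case₇ (+ p) (T p) ε₁ ε₂ ε₃))
  where
  open OddPrime p pr 2∤p

  conclude : ∀ {s t E} → χ {p} (⊝ 1𝔽) ≡ s × χ 2𝔽 ≡ t →
    8N-formula (+ p) s t (T p) ε₁ ε₂ ε₃ ≡ E → + N p ε₁ ε₂ ε₃ / 1 ≡ E / 8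
  conclude (s≡ , t≡) eq = 8*n≡E⇒n≡E/8 (N p ε₁ ε₂ ε₃) (trans (8N ±ε₁ ±ε₂ ±ε₃)
    (trans (cong₂ (λ s t → 8N-formula (+ p) s t (T p) ε₁ ε₂ ε₃) s≡ t≡) eq))

  case₃ : ∀ P τ ε₁ ε₂ ε₃ →
    P - + 3 - 0ℤ * ε₁ - 0ℤ * ε₂ - 0ℤ * ε₃ - 0ℤ * ε₁ * ε₂ - 0ℤ * ε₁ * ε₃ - 0ℤ * ε₂ * ε₃ + ε₁ * ε₂ * ε₃ * τ ≡
    P - + 3 + ε₁ * ε₂ * ε₃ * τ
  case₃ = solve-∀
  case₅ : ∀ P τ ε₁ ε₂ ε₃ →
    P - + 3 - 0ℤ * ε₁ - + 2 * ε₂ - 0ℤ * ε₃ - 0ℤ * ε₁ * ε₂ - + 2 * ε₁ * ε₃ - 0ℤ * ε₂ * ε₃ + ε₁ * ε₂ * ε₃ * τ ≡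
    P - + 3 - + 2 * ε₂ - + 2 * ε₁ * ε₃ + ε₁ * ε₂ * ε₃ * τ
  case₅ = solve-∀
  case₇ : ∀ P τ ε₁ ε₂ ε₃ →
    P - + 3 - (- + 2) * ε₁ - 0ℤ * ε₂ - + 2 * ε₃ - + 2 * ε₁ * ε₂ - 0ℤ * ε₁ * ε₃ - + 2 * ε₂ * ε₃ + ε₁ * ε₂ * ε₃ * τ ≡
    P - + 3 + + 2 * ε₁ - + 2 * ε₃ - + 2 * ε₁ * ε₂ - + 2 * ε₂ * ε₃ + ε₁ * ε₂ * ε₃ * τ
  case₇ = solve-∀
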